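{- Let $P$ be a countable poset with no infinite antichain which is vacillating. Then $P$ contains a spine, i.e. there is a chain $C\subseteq P$ and a partition of $P$ into antichains $(A_i : i\in I)$ such that $C$ meets every $A_i$.
   Context: A chain $C$ in a poset $P$ is contiguous if there is no $x\in P\setminus C$ and $y,z\in C$ with $y<x<z$ and $C\cup\{x\}$ a chain. For a total order $I$ and posets $(C_i : i\in I)$, the linear sum $\bigoplus_{i\in I}C_i$ is the disjoint union in which all elements of $C_j$ are greater than all elements of $C_i$ whenever $j>i$ in $I$ (and each $C_i$ keeps its own order). $C^*$ denotes the reverse order of $C$. A poset is co-wellfounded if it has no infinite strictly increasing sequence. $\omega$ denotes the order type of the natural numbers. A poset $P$ is vacillating if there is no contiguous chain $C$ of $P$ such that $C$ or $C^*$ can be written as $\bigoplus_{i\in\omega}C_i$ with each $C_i$ infinite and co-wellfounded. A spine of $P$ is a chain $C$ for which there is a partition of $P$ into antichains each of which meets $C$. -}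

module Defs where

open import Data.Nat using (ℕ; suc) renaming (_<_ to _<ℕ_)
open import Data.List using (List)
open import Data.List.Membership.Propositional using (_∈_)
open import Data.Product using (Σ; _×_; ∃)
open import Data.Sum using (_⊎_)
open import Data.Empty using (⊥)
open import Relation.Nullary using (¬_; Dec)
open import Relation.Binary.PropositionalEquality using (_≡_; _≢_)
open import Relation.Binary.Structures using (IsPartialOrder)
open import Function.Definitions using (Injective)

Subset : Set → Set₁
Subset A = A → Set

Finite : {A : Set} → Subset A → Set
Finite {A} S = Σ (List A) λ xs → ∀ x → S x → x ∈ xs

Infinite : {A : Set} → Subset A → Set
Infinite S = ¬ Finite S

Countable : Set → Set
Countable A = Σ (A → ℕ) λ f → Injective _≡_ _≡_ f

module PosetNotions {A : Set} (_≤_ : A → A → Set) where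

  _<_ : A → A → Set
  x < y = (x ≤ y) × (x ≢ y)

  Comparable : A → A → Set
  Comparable x y = (x ≤ y) ⊎ (y ≤ x)

  Chain : Subset A → Set
  Chain C = ∀ x y → C x → C y → Comparable x y

  Antichain : Subset A → Set
  Antichain S = ∀ x y → S x → S y → x ≤ y → x ≡ y

  NoInfiniteAntichain : Set₁
  NoInfiniteAntichain = (S : Subset A) → Antichain S → ¬ Infinite S

  Contiguous : Subset A → Set
  Contiguous C = ∀ x y z → ¬ C x → C y → C z → y < x → x < z →
                 ¬ (∀ c → C c → Comparable c x)

  CoWellfounded : (A → A → Set) → Subset A → Set
  CoWellfounded R S =
    ¬ (Σ (ℕ → A) λ f → (∀ n → S (f n)) × (∀ n → R (f n) (f (suc n))))

  -- The chain C, ordered by the strict order R (either _<_ or its reverse),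
  -- is a linear sum ⊕_{i∈ω} C_i, with C_i = {x ∈ C | g x ≡ i} each
  -- infinite and co-wellfounded (w.r.t. R).
  OmegaSum : (A → A → Set) → Subset A → Set
  OmegaSum R C = Σ (A → ℕ) λ g →
    (∀ x y → C x → C y → g x <ℕ g y → R x y) ×
    (∀ i → Infinite (λ x → C x × (g x ≡ i))
         × CoWellfounded R (λ x → C x × (g x ≡ i)))

  Reverse : (A → A → Set) → A → A → Set
  Reverse R x y = R y x

  Vacillating : Set₁
  Vacillating = (C : Subset A) → Chain C → Contiguous C →
                ¬ OmegaSum _<_ C × ¬ OmegaSum (Reverse _<_) C

  -- A spine: a chain C and a partition of A into antichains
  -- (the fibres of f : A → I) each of which meets C.
  HasSpine : Set₁
  HasSpine = Σ (Subset A) λ C → Chain C ×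
    Σ Set λ I → Σ (A → I) λ f →
      (∀ x y → f x ≡ f y → x ≤ y → x ≡ y) ×
      (∀ i → Σ A λ c → C c × (f c ≡ i))

-- Classical logic (the paper works in ZFC).
ExcludedMiddle : Set₁
ExcludedMiddle = (X : Set) → Dec X

{-# OPTIONS --safe #-}
module Submission where

-- Write x ∥ y for incomparability. Call a chain D safe if every d ∈ D is incomparable to only finitely
-- many elements x such that {e ∈ D : e ∥ x} is finite. Enlarging D only helps, so safe chains are closed
-- under increasing unions, and there is a maximal one. The heart of the matter is that every non-empty
-- convex set Q contains a non-empty safe chain; applied to the gaps of a maximal safe chain D it shows
-- that every element outside D is incomparable to some element of D.
--
-- To find a safe chain in Q: if infinitely many elements of Q have finite down-sets, take an ascending
-- sequence of such elements generating a minimal ideal, and dually. Otherwise some z ∈ Q (a source) has a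
-- descending sequence below it and an ascending one above it. If Q contains no dense chain, then Q can be
-- shrunk until its sources are locally finite: an infinite shrinking would produce ω or ω* many infinite
-- (co-)well-founded intervals in a row, which is what vacillation forbids. Minimal ideals and filters of
-- the sources then yield a safe chain of type ℤ. If Q contains dense chains, one may assume, by
-- passing to elements incomparable to a finite set, that the elements incomparable to any given one
-- contain none; then the gaps around the points of a maximal dense chain contain no dense chain, and the
-- union of safe chains chosen in these gaps is safe.
--
-- Let R be the set of x incomparable to only finitely many elements of the maximal safe chain D. Each
-- element of R is incomparable to only finitely many others, so R has a spine by compactness from the
-- finite case. Every other element is incomparable to infinitely many of the antichains obtained, and can
-- be adjoined to one of them, a different one for each element.

open import Defs
open import Relation.Binary.PropositionalEquality using (_≡_)
open import Relation.Binary.Structures using (IsPartialOrder)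
open import Relation.Binary.PropositionalEquality using (_≢_; refl; sym; trans; cong; subst; subst₂; isEquivalence)
open import Relation.Binary.PropositionalEquality.WithK using (≡-irrelevant)
open import Relation.Binary.Definitions using (tri<; tri≈; tri>)
open import Relation.Nullary using (¬_; Dec; yes; no; does)
open import Relation.Nullary.Decidable using (decidable-stable; dec-true)
open import Data.Bool using (Bool; true; false)
open import Data.Nat using (ℕ; zero; suc; _+_; _⊔_; z≤n; s≤s) renaming (_≤_ to _≤ₙ_; _<_ to _<ₙ_)
import Data.Nat.Properties as ℕ
open import Data.Nat.Induction using (<-rec)
open import Data.List using (List; []; _∷_; _++_; length; filter)
open import Data.List.Properties using (filter-notAll)
open import Data.List.Relation.Unary.Any using (here; there)
open import Data.List.Membership.Propositional using (_∈_; _∉_; lose)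
open import Data.List.Membership.Propositional.Properties using (∈-++⁺ˡ; ∈-++⁺ʳ; ∈-filter⁺; ∈-filter⁻)
open import Data.Product using (Σ; Σ-syntax; _×_; _,_; proj₁; proj₂)
open import Data.Sum using (_⊎_; inj₁; inj₂; swap)
open import Data.Empty using (⊥; ⊥-elim)
open import Data.Unit using (⊤; tt)
open import Function using (flip; _∘_; id; case_of_)
open import Function.Definitions using (Injective)

-- Finite sets and sequences

iterate : {X : Set} → (X → X) → X → ℕ → X
iterate f x zero    = x
iterate f x (suc n) = f (iterate f x n)

abstract
  dependentChoice : {X : Set} {R : X → X → Set} → (∀ x → Σ X (R x)) → X →
    Σ[ s ∈ (ℕ → X) ] ∀ n → R (s n) (s (suc n))
  dependentChoice f x = iterate (λ y → proj₁ (f y)) x , λ n → proj₂ (f _)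

module _ {A : Set} where

  finite-⊆ : {S T : Subset A} → (∀ x → S x → T x) → Finite T → Finite S
  finite-⊆ S⊆T (xs , cover) = xs , λ x Sx → cover x (S⊆T x Sx)

  finite-∪ : {S T : Subset A} → Finite S → Finite T → Finite (λ x → S x ⊎ T x)
  finite-∪ (xs , coverS) (ys , coverT) = xs ++ ys , λ where
    x (inj₁ Sx) → ∈-++⁺ˡ (coverS x Sx)
    x (inj₂ Tx) → ∈-++⁺ʳ xs (coverT x Tx)

  finite-⋃ : (T : A → Subset A) (xs : List A) → (∀ x → Finite (T x)) →
    Finite (λ y → Σ[ x ∈ A ] x ∈ xs × T x y)
  finite-⋃ T [] fin = [] , λ { y (x , () , _) }
  finite-⋃ T (x ∷ xs) fin = finite-⊆ split (finite-∪ (fin x) (finite-⋃ T xs fin))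
    where
    split : ∀ y → Σ[ z ∈ A ] z ∈ (x ∷ xs) × T z y → T x y ⊎ (Σ[ z ∈ A ] z ∈ xs × T z y)
    split y (.x , here refl , t) = inj₁ t
    split y (z , there i , t)    = inj₂ (z , i , t)

  Injectiveℕ : (ℕ → A) → Set
  Injectiveℕ s = ∀ {i j} → s i ≡ s j → i ≡ j

module Classical (em : ExcludedMiddle) where

  abstract
    byContradiction : {X : Set} → ¬ ¬ X → X
    byContradiction {X} = decidable-stable (em X)

  module _ {A : Set} where

    eventually∉ : {s : ℕ → A} → Injectiveℕ s → (xs : List A) →
      Σ[ N ∈ ℕ ] ∀ n → N ≤ₙ n → s n ∉ xs
    eventually∉ inj [] = 0 , λ { n _ () }
    eventually∉ {s} inj (x ∷ xs) with eventually∉ inj xs | em (Σ[ n ∈ ℕ ] s n ≡ x)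
    ... | N , out | no never = N , λ where
      n N≤n (here e)  → never (n , e)
      n N≤n (there i) → out n N≤n i
    ... | N , out | yes (m , sm≡x) = suc m ⊔ N , λ where
      n le (here e)  → ℕ.<-irrefl (inj (trans sm≡x (sym e))) (ℕ.m⊔n≤o⇒m≤o (suc m) N le)
      n le (there i) → out n (ℕ.m⊔n≤o⇒n≤o (suc m) N le) i

    eventually-leaves : {s : ℕ → A} {S : Subset A} → Injectiveℕ s → Finite S →
      Σ[ N ∈ ℕ ] ∀ n → N ≤ₙ n → ¬ S (s n)
    eventually-leaves inj (xs , cover) with eventually∉ inj xs
    ... | N , out = N , λ n N≤n Ssn → out n N≤n (cover _ Ssn)

    injective⇒infinite : {s : ℕ → A} {S : Subset A} → Injectiveℕ s → (∀ n → S (s n)) → Infinite S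
    injective⇒infinite inj s∈S fin with eventually-leaves inj fin
    ... | N , out = out N ℕ.≤-refl (s∈S N)

    infinite-∖ : {S T : Subset A} → Infinite S → Finite T → Σ[ x ∈ A ] S x × ¬ T x
    infinite-∖ inf fin = byContradiction λ none →
      inf (finite-⊆ (λ x Sx → byContradiction λ ¬Tx → none (x , Sx , ¬Tx)) fin)

-- Zorn's lemma on a countable set, for families closed under unions of increasing sequences

module Zorn (em : ExcludedMiddle) {A : Set} (code : A → ℕ) (code-injective : Injective _≡_ _≡_ code) where

  -- Boolean-valued, so that the subsets form a type in `Set` and excluded middle can decide whether
  -- a subset with a given property exists. Membership proofs are also unique.
  Sub : Set
  Sub = A → Bool

  _∋_ : Sub → A → Set
  D ∋ x = D x ≡ true

  ⟦_⟧ : Subset A → Sub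
  ⟦ S ⟧ x = does (em (S x))

  ∋⁺ : ∀ {S : Subset A} {x} → S x → ⟦ S ⟧ ∋ x
  ∋⁺ {S} {x} Sx = dec-true (em (S x)) Sx

  ∋⁻ : ∀ {S : Subset A} {x} → ⟦ S ⟧ ∋ x → S x
  ∋⁻ {S} {x} e with em (S x)
  ... | yes Sx = Sx

  Increasing : (ℕ → Sub) → Set
  Increasing s = ∀ n x → s n ∋ x → s (suc n) ∋ x

  increasing-≤ : ∀ {s} → Increasing s → ∀ {i j x} → i ≤ₙ j → s i ∋ x → s j ∋ x
  increasing-≤ inc {zero} {zero} z≤n sx = sx
  increasing-≤ inc {i} {suc j} i≤1+j sx with ℕ.m≤n⇒m<n∨m≡n i≤1+j
  ... | inj₁ i<1+j = inc j _ (increasing-≤ inc (ℕ.m<1+n⇒m≤n i<1+j) sx)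
  ... | inj₂ refl  = sx

  ⋃ : (ℕ → Sub) → Subset A
  ⋃ s x = Σ[ n ∈ ℕ ] s n ∋ x

  common-stage : ∀ {s x y} → Increasing s → ⋃ s x → ⋃ s y → Σ[ n ∈ ℕ ] s n ∋ x × s n ∋ y
  common-stage inc (m , sx) (n , sy) =
    m ⊔ n , increasing-≤ inc (ℕ.m≤m⊔n m n) sx , increasing-≤ inc (ℕ.m≤n⊔m m n) sy

  Maximal : (Sub → Set) → Sub → Set
  Maximal 𝓕 D = ∀ {E} → 𝓕 E → (∀ {x} → D ∋ x → E ∋ x) → ∀ {x} → E ∋ x → D ∋ x

  -- At stage n the element with code n is adjoined if some larger member of 𝓕 contains it.
  zorn : (𝓕 : Sub → Set) → (∀ s → (∀ n → 𝓕 (s n)) → Increasing s → 𝓕 ⟦ ⋃ s ⟧) → ∀ {D₀} → 𝓕 D₀ →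
    Σ[ D ∈ Sub ] 𝓕 D × (∀ {x} → D₀ ∋ x → D ∋ x) × Maximal 𝓕 D
  zorn 𝓕 closed {D₀} 𝓕D₀ =
    ⟦ ⋃ s ⟧ , closed s (λ n → proj₂ (stage n)) increasing , (λ D₀x → ∋⁺ {⋃ s} (0 , D₀x)) , maximal
    where
    Candidate : ℕ → Sub → Sub → Set
    Candidate n D E = 𝓕 E × (∀ {x} → D ∋ x → E ∋ x) × Σ[ x ∈ A ] code x ≡ n × E ∋ x
    extend : ℕ → Σ Sub 𝓕 → Σ Sub 𝓕
    extend n (D , 𝓕D) with em (Σ Sub (Candidate n D))
    ... | yes (E , 𝓕E , _) = E , 𝓕E
    ... | no _             = D , 𝓕D
    stage : ℕ → Σ Sub 𝓕
    stage zero    = D₀ , 𝓕D₀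
    stage (suc n) = extend n (stage n)
    s : ℕ → Sub
    s n = proj₁ (stage n)
    increasing : Increasing s
    increasing n x sx with em (Σ Sub (Candidate n (s n)))
    ... | yes (_ , _ , D⊆E , _) = D⊆E sx
    ... | no _                  = sx
    maximal : Maximal 𝓕 ⟦ ⋃ s ⟧
    maximal {E} 𝓕E D⊆E {x} Ex = ∋⁺ {⋃ s} (suc (code x) , caught)
      where
      -- `E` is itself a candidate at stage `code x`, so some candidate was chosen there; the
      -- element with that code which it contains can only be `x`.
      caught : s (suc (code x)) ∋ x
      caught with em (Σ Sub (Candidate (code x) (s (code x))))
      ... | yes (E′ , _ , _ , x′ , same-code , E′x′) = subst (E′ ∋_) (code-injective same-code) E′x′
      ... | no none = ⊥-elim (none (E , 𝓕E , (λ sx → D⊆E (∋⁺ {⋃ s} (code x , sx))) , x , refl , Ex))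

-- Ascending and descending sequences

flip-isPartialOrder : {A : Set} {_≤_ : A → A → Set} → IsPartialOrder _≡_ _≤_ → IsPartialOrder _≡_ (flip _≤_)
flip-isPartialOrder po = record
  { isPreorder = record
    { isEquivalence = isEquivalence
    ; reflexive     = λ { refl → IsPartialOrder.refl po }
    ; trans         = λ p q → IsPartialOrder.trans po q p
    }
  ; antisym = λ p q → IsPartialOrder.antisym po q p
  }

module Sequences {A : Set} (_≤_ : A → A → Set) (po : IsPartialOrder _≡_ _≤_) where

  open IsPartialOrder po public using (antisym) renaming (refl to ≤-refl; trans to ≤-trans)
  open PosetNotions _≤_ public using (_<_)

  ≤-<-trans : ∀ {x y z} → x ≤ y → y < z → x < z
  ≤-<-trans p (q , ne) = ≤-trans p q , λ { refl → ne (antisym q p) }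

  <-≤-trans : ∀ {x y z} → x < y → y ≤ z → x < z
  <-≤-trans (p , ne) q = ≤-trans p q , λ { refl → ne (antisym p q) }

  <-trans : ∀ {x y z} → x < y → y < z → x < z
  <-trans x<y y<z = <-≤-trans x<y (proj₁ y<z)

  <⇒≱ : ∀ {x y} → x < y → ¬ y ≤ x
  <⇒≱ (p , ne) q = ne (antisym p q)

  Asc : (ℕ → A) → Set
  Asc s = ∀ n → s n < s (suc n)

  asc-≤ : ∀ {s} → Asc s → ∀ {i j} → i ≤ₙ j → s i ≤ s j
  asc-≤ asc {zero}  {zero}  z≤n = ≤-refl
  asc-≤ asc {i}     {suc j} i≤1+j with ℕ.m≤n⇒m<n∨m≡n i≤1+j
  ... | inj₁ i<1+j = ≤-trans (asc-≤ asc (ℕ.m<1+n⇒m≤n i<1+j)) (proj₁ (asc j))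
  ... | inj₂ refl  = ≤-refl

  asc-< : ∀ {s} → Asc s → ∀ {i j} → i <ₙ j → s i < s j
  asc-< asc {i} i<j = <-≤-trans (asc i) (asc-≤ asc i<j)

  asc-injective : ∀ {s} → Asc s → Injectiveℕ s
  asc-injective asc {i} {j} e with ℕ.<-cmp i j
  ... | tri< i<j _ _ = ⊥-elim (proj₂ (asc-< asc i<j) e)
  ... | tri≈ _ i≡j _ = i≡j
  ... | tri> _ _ j<i = ⊥-elim (proj₂ (asc-< asc j<i) (sym e))

  asc-drop : ∀ {s} → Asc s → ∀ k → Asc (λ n → s (n + k))
  asc-drop asc k n = asc (n + k)

-- This module is instantiated both for an order and for its reverse. Incomparability is a
-- parameter in order to be literally the same relation both times.

module Order (em : ExcludedMiddle) {A : Set} (_≤_ : A → A → Set) (po : IsPartialOrder _≡_ _≤_)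
  (_∥_ : A → A → Set)
  (∥⇒≰ : ∀ {x y} → x ∥ y → ¬ x ≤ y) (∥⇒≱ : ∀ {x y} → x ∥ y → ¬ y ≤ x)
  (≰≱⇒∥ : ∀ {x y} → ¬ x ≤ y → ¬ y ≤ x → x ∥ y)
  (antichain-finite : (S : Subset A) → (∀ x y → S x → S y → x ≢ y → x ∥ y) → Finite S)
  (code : A → ℕ) (code-injective : Injective _≡_ _≡_ code)
  where

  open Classical em
  open Zorn em code code-injective
  open Sequences _≤_ po
  module Reversed = Sequences (flip _≤_) (flip-isPartialOrder po)

  Desc : (ℕ → A) → Set
  Desc = Reversed.Asc

  _⊑_ : (ℕ → A) → Subset A → Set
  s ⊑ S = ∀ n → S (s n)

  ∥-sym : ∀ {x y} → x ∥ y → y ∥ x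
  ∥-sym p = ≰≱⇒∥ (∥⇒≱ p) (∥⇒≰ p)

  ∥-irrefl : ∀ {x} → ¬ x ∥ x
  ∥-irrefl p = ∥⇒≰ p ≤-refl

  compare : ∀ x y → x ≤ y ⊎ y ≤ x ⊎ x ∥ y
  compare x y with em (x ≤ y) | em (y ≤ x)
  ... | yes p | _     = inj₁ p
  ... | no _  | yes q = inj₂ (inj₁ q)
  ... | no p  | no q  = inj₂ (inj₂ (≰≱⇒∥ p q))

  ∥-convex : ∀ {x y z w} → x ∥ w → z ∥ w → x ≤ y → y ≤ z → y ∥ w
  ∥-convex x∥w z∥w x≤y y≤z =
    ≰≱⇒∥ (λ y≤w → ∥⇒≰ x∥w (≤-trans x≤y y≤w)) (λ w≤y → ∥⇒≱ z∥w (≤-trans w≤y y≤z))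

  Convex : Subset A → Set
  Convex Q = ∀ {x y z} → Q x → Q z → x ≤ y → y ≤ z → Q y

  -- `P` is the invariant under which a further element, incomparable to all earlier ones, can still
  -- be found. Keeping the whole history in the state makes the chosen elements pairwise
  -- incomparable.
  no-infinite-antichain : (P : List A → Set) → P [] →
    (∀ es → P es → Σ[ e ∈ A ] P (e ∷ es) × (∀ e′ → e′ ∈ es → e′ ∥ e)) → ⊥
  no-infinite-antichain P p₀ step = injective⇒infinite inj (λ n → n , refl) (antichain-finite S anti)
    where
    history : ℕ → Σ (List A) P
    history = iterate (λ (es , p) → proj₁ (step es p) ∷ es , proj₁ (proj₂ (step es p))) ([] , p₀)
    e : ℕ → A
    e n = proj₁ (step (proj₁ (history n)) (proj₂ (history n)))
    remembered : ∀ {i j} → i <ₙ j → e i ∈ proj₁ (history j)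
    remembered {i} {suc j} i<1+j with ℕ.m≤n⇒m<n∨m≡n (ℕ.m<1+n⇒m≤n i<1+j)
    ... | inj₁ i<j  = there (remembered i<j)
    ... | inj₂ refl = here refl
    e-∥ : ∀ {i j} → i <ₙ j → e i ∥ e j
    e-∥ {i} {j} i<j = proj₂ (proj₂ (step _ (proj₂ (history j)))) (e i) (remembered i<j)
    S : Subset A
    S x = Σ[ n ∈ ℕ ] e n ≡ x
    anti : ∀ x y → S x → S y → x ≢ y → x ∥ y
    anti _ _ (i , refl) (j , refl) ne with ℕ.<-cmp i j
    ... | tri< i<j _ _  = e-∥ i<j
    ... | tri≈ _ refl _ = ⊥-elim (ne refl)
    ... | tri> _ _ j<i  = ∥-sym (e-∥ j<i)
    inj : Injectiveℕ e
    inj {i} {j} eq with ℕ.<-cmp i j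
    ... | tri< i<j _ _ = ⊥-elim (∥-irrefl (subst (e i ∥_) (sym eq) (e-∥ i<j)))
    ... | tri≈ _ i≡j _ = i≡j
    ... | tri> _ _ j<i = ⊥-elim (∥-irrefl (subst (e j ∥_) eq (e-∥ j<i)))

  -- Monotone sequences in infinite sets

  HasAsc HasDesc : Subset A → Set
  HasAsc S  = Σ[ s ∈ (ℕ → A) ] Asc s × s ⊑ S
  HasDesc S = Σ[ s ∈ (ℕ → A) ] Desc s × s ⊑ S

  Minimal : Subset A → A → Set
  Minimal S m = ∀ y → S y → y ≤ m → y ≡ m

  minimal-below : ∀ {S} → ¬ HasDesc S → ∀ {x} → S x → Σ[ m ∈ A ] S m × m ≤ x × Minimal S m
  minimal-below {S} noDesc {x} Sx = byContradiction λ none →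
    let smaller : ((y , _) : Σ[ y ∈ A ] S y × y ≤ x) → Σ[ z ∈ (Σ[ z ∈ A ] S z × z ≤ x) ] proj₁ z < y
        smaller (y , Sy , y≤x) = byContradiction λ minimal →
          none (y , Sy , y≤x , λ z Sz z≤y → byContradiction λ z≢y →
            minimal ((z , Sz , ≤-trans z≤y y≤x) , z≤y , z≢y))
        (s , down) = dependentChoice {R = λ y z → proj₁ z < proj₁ y} smaller (x , Sx , ≤-refl)
    in noDesc (proj₁ ∘ s , (λ n → proj₁ (down n) , λ e → proj₂ (down n) (sym e)) , λ n → proj₁ (proj₂ (s n)))

  -- The finitely many minimal elements of S have S in their up-closure.
  infinite-above : ∀ {S} → ¬ HasDesc S → Infinite S → Σ[ m ∈ A ] S m × Infinite (λ x → S x × m < x)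
  infinite-above {S} noDesc inf = byContradiction contra
    where
    M : Subset A
    M m = S m × Minimal S m
    M-finite : Finite M
    M-finite = antichain-finite M λ x y (Sx , minx) (Sy , miny) x≢y →
      ≰≱⇒∥ (λ x≤y → x≢y (miny x Sx x≤y)) (λ y≤x → x≢y (sym (minx y Sy y≤x)))
    Above : A → Subset A
    Above m x = S m × S x × m < x
    split : ∀ x → S x → M x ⊎ (Σ[ m ∈ A ] m ∈ proj₁ M-finite × Above m x)
    split x Sx with minimal-below noDesc Sx
    ... | m , Sm , m≤x , min with em (m ≡ x)
    ...   | yes refl = inj₁ (Sm , min)
    ...   | no m≢x   = inj₂ (m , proj₂ M-finite m (Sm , min) , Sm , Sx , m≤x , m≢x)
    contra : ¬ ¬ (Σ[ m ∈ A ] S m × Infinite (λ x → S x × m < x))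
    contra none = inf (finite-⊆ split (finite-∪ M-finite (finite-⋃ Above (proj₁ M-finite) above-finite)))
      where
      above-finite : ∀ m → Finite (Above m)
      above-finite m = byContradiction λ inf′ → inf′ ([] , λ x (Sm , Sx , m<x) →
        ⊥-elim (none (m , Sm , λ fin → inf′ (finite-⊆ (λ _ → proj₂) fin))))

  -- Without a descending sequence, `infinite-above` can be applied again and again, each time
  -- inside the infinite up-set of the element just found.
  infinite⇒monotone : ∀ {S} → Infinite S → HasAsc S ⊎ HasDesc S
  infinite⇒monotone {S} inf with em (HasDesc S)
  ... | yes desc  = inj₂ desc
  ... | no noDesc = inj₁ (proj₁ ∘ s , proj₂ chosen , λ n → proj₁ (proj₂ (s n)))
    where
    State : Set
    State = Σ[ m ∈ A ] S m × Infinite (λ x → S x × m < x)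
    next : (t : State) → Σ[ t′ ∈ State ] proj₁ t < proj₁ t′
    next (m , Sm , inf′) with infinite-above (λ (d , desc , d∈) → noDesc (d , desc , λ n → proj₁ (d∈ n))) inf′
    ... | m′ , (Sm′ , m<m′) , inf″ = (m′ , Sm′ , λ fin → inf″ (finite-⊆ (λ x ((Sx , _) , p) → Sx , p) fin)) , m<m′
    chosen : Σ[ s ∈ (ℕ → State) ] Asc (proj₁ ∘ s)
    chosen = dependentChoice {R = λ t t′ → proj₁ t < proj₁ t′} next (infinite-above noDesc inf)
    s : ℕ → State
    s = proj₁ chosen

  asc-not-in-finite : ∀ {S s} → Asc s → s ⊑ S → ¬ Finite S
  asc-not-in-finite asc s∈S fin = injective⇒infinite (asc-injective asc) s∈S fin

  -- Locally finite sets and minimal ideals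

  LocallyFinite : Subset A → Set
  LocallyFinite Z = ∀ {a b} → Z a → Z b → Finite (λ x → Z x × a ≤ x × x ≤ b)

  -- The terms of `s` below `e` all lie in the finite interval from `s 0` to `e`.
  asc-escapes : ∀ {Z s e} → LocallyFinite Z → Asc s → s ⊑ Z → Z e →
    Σ[ N ∈ ℕ ] ∀ n → N ≤ₙ n → ¬ s n ≤ e
  asc-escapes lf asc s∈Z Ze with eventually-leaves (asc-injective asc) (lf (s∈Z 0) Ze)
  ... | N , out = N , λ n N≤n sn≤e → out n N≤n (s∈Z n , asc-≤ asc z≤n , sn≤e)

  asc-escapes-list : ∀ {Z s} → LocallyFinite Z → Asc s → s ⊑ Z → (es : List A) → (∀ e → e ∈ es → Z e) →
    Σ[ N ∈ ℕ ] ∀ n → N ≤ₙ n → ∀ e → e ∈ es → ¬ s n ≤ e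
  asc-escapes-list lf asc s∈Z [] es⊆Z = 0 , λ { n _ e () }
  asc-escapes-list lf asc s∈Z (e ∷ es) es⊆Z
    with asc-escapes lf asc s∈Z (es⊆Z e (here refl)) | asc-escapes-list lf asc s∈Z es (λ e′ i → es⊆Z e′ (there i))
  ... | N , out | N′ , out′ = N ⊔ N′ , λ where
    n le _ (here refl) → out n (ℕ.m⊔n≤o⇒m≤o N N′ le)
    n le e′ (there i)  → out′ n (ℕ.m⊔n≤o⇒n≤o N N′ le) e′ i

  -- The ideal generated by u contains no smaller ideal generated by an ascending sequence of Z.
  MinimalAsc : Subset A → (ℕ → A) → Set
  MinimalAsc Z u = ∀ n → ¬ (Σ[ y ∈ (ℕ → A) ] Asc y × y ⊑ Z × (∀ k → y k ∥ u n) × (∀ k → Σ[ m ∈ ℕ ] y k ≤ u m))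

  -- Otherwise passing to smaller and smaller ideals produces an infinite antichain.
  minimalAsc-exists : ∀ {Z} → LocallyFinite Z → HasAsc Z → Σ[ u ∈ (ℕ → A) ] Asc u × u ⊑ Z × MinimalAsc Z u
  minimalAsc-exists {Z} lf (s , asc-s , s∈Z) = byContradiction λ none →
    no-infinite-antichain P (s , asc-s , s∈Z , (λ e ()) , λ e ()) (λ es p → step none es p)
    where
    P : List A → Set
    P es = Σ[ u ∈ (ℕ → A) ] Asc u × u ⊑ Z × (∀ e → e ∈ es → Z e) × (∀ e → e ∈ es → ∀ i → e ∥ u i)
    step : ¬ (Σ[ u ∈ (ℕ → A) ] Asc u × u ⊑ Z × MinimalAsc Z u) → ∀ es → P es →
      Σ[ e ∈ A ] P (e ∷ es) × (∀ e′ → e′ ∈ es → e′ ∥ e)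
    step none es (u , asc-u , u∈Z , es⊆Z , es∥u)
      with byContradiction (λ all-minimal → none (u , asc-u , u∈Z , λ n bad → all-minimal (n , bad)))
    ... | n , y , asc-y , y∈Z , y∥un , y≤u with asc-escapes-list lf asc-y y∈Z es es⊆Z
    -- The term `u n` joins the antichain and a tail of `y` replaces `u`. The tail lies below no
    -- earlier `e` by local finiteness, and above none because each `y k` is below some `u m`.
    ...   | N , out = u n , (y′ , asc-drop asc-y N , (λ k → y∈Z (k + N)) , in-Z , in-∥) , λ e i → es∥u e i n
      where
      y′ : ℕ → A
      y′ k = y (k + N)
      in-Z : ∀ e → e ∈ (u n ∷ es) → Z e
      in-Z _ (here refl) = u∈Z n
      in-Z e (there i)   = es⊆Z e i
      in-∥ : ∀ e → e ∈ (u n ∷ es) → ∀ k → e ∥ y′ k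
      in-∥ _ (here refl) k = ∥-sym (y∥un (k + N))
      in-∥ e (there i)   k with y≤u (k + N)
      ... | m , y≤um = ≰≱⇒∥ (λ e≤y → ∥⇒≰ (es∥u e i m) (≤-trans e≤y y≤um)) (out (k + N) (ℕ.m≤n+m N k) e i)

  -- Sources of a convex set

  DescBelow AscAbove Source : Subset A → A → Set
  DescBelow Q z = Σ[ d ∈ (ℕ → A) ] Desc d × d ⊑ Q × (∀ n → d n ≤ z)
  AscAbove  Q z = Σ[ u ∈ (ℕ → A) ] Asc u × u ⊑ Q × (∀ n → z ≤ u n)
  Source    Q z = Q z × DescBelow Q z × AscAbove Q z

  Sourced : Subset A → Set
  Sourced Q = Σ A (Source Q)

  _↓_ _↑_ : Subset A → A → Subset A
  (Q ↓ r) x = Q x × x ≤ r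
  (Q ↑ l) x = Q x × l ≤ x

  NoMid : Subset A → Set
  NoMid Q = ¬ (Σ[ z ∈ A ] Q z × Sourced (Q ↓ z) × Sourced (Q ↑ z))

  -- A right step is a source at which `Q` can be cut off from above so that the lower part, taken
  -- by itself, still has a source. Left steps are dual.
  RightStep LeftStep : Subset A → A → Set
  RightStep Q r = Source Q r × Sourced (Q ↓ r)
  LeftStep  Q l = Source Q l × Sourced (Q ↑ l)

  _⊆_ : Subset A → Subset A → Set
  S ⊆ T = ∀ {x} → S x → T x

  source-mono : ∀ Q Q′ → Q ⊆ Q′ → Source Q ⊆ Source Q′
  source-mono Q Q′ Q⊆Q′ (Qz , (d , desc , d∈ , d≤z) , (u , asc , u∈ , z≤u)) =
    Q⊆Q′ Qz , (d , desc , (λ n → Q⊆Q′ (d∈ n)) , d≤z) , (u , asc , (λ n → Q⊆Q′ (u∈ n)) , z≤u)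

  sourced-mono : ∀ Q Q′ → Q ⊆ Q′ → Sourced Q → Sourced Q′
  sourced-mono Q Q′ Q⊆Q′ (z , source) = z , source-mono Q Q′ Q⊆Q′ source

  noMid-mono : ∀ Q Q′ → Q ⊆ Q′ → NoMid Q′ → NoMid Q
  noMid-mono Q Q′ Q⊆Q′ noMid (z , Qz , lower , upper) = noMid (z , Q⊆Q′ Qz ,
    sourced-mono (Q ↓ z) (Q′ ↓ z) (λ (q , p) → Q⊆Q′ q , p) lower ,
    sourced-mono (Q ↑ z) (Q′ ↑ z) (λ (q , p) → Q⊆Q′ q , p) upper)

  rightStep-mono : ∀ Q Q′ → Q ⊆ Q′ → RightStep Q ⊆ RightStep Q′
  rightStep-mono Q Q′ Q⊆Q′ {r} (source , sourced) =
    source-mono Q Q′ Q⊆Q′ source , sourced-mono (Q ↓ r) (Q′ ↓ r) (λ (q , p) → Q⊆Q′ q , p) sourced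

  ↓-convex : ∀ Q r → Convex Q → Convex (Q ↓ r)
  ↓-convex Q r convex (Qx , _) (Qz , z≤r) x≤y y≤z = convex Qx Qz x≤y y≤z , ≤-trans y≤z z≤r

  ascAbove-drop : ∀ Q {u} → Asc u → u ⊑ Q → ∀ k → AscAbove Q (u k)
  ascAbove-drop Q {u} asc u∈Q k =
    (λ n → u (n + k)) , asc-drop asc k , (λ n → u∈Q (n + k)) , λ n → asc-≤ asc (ℕ.m≤n+m k n)

  sources-ascend : ∀ Q {z} → Source Q z → AscAbove (Source Q) z
  sources-ascend Q (Qz , (d , desc , d∈Q , d≤z) , (u , asc , u∈Q , z≤u)) = u , asc , source , z≤u
    where
    source : u ⊑ Source Q
    source k = u∈Q k , (d , desc , d∈Q , λ n → ≤-trans (d≤z n) (z≤u k)) , ascAbove-drop Q asc u∈Q k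

  source-convex : ∀ Q → Convex Q → Convex (Source Q)
  source-convex Q convex (Qx , (d , desc , d∈ , d≤x) , _) (Qz , _ , (u , asc , u∈ , z≤u)) x≤y y≤z =
    convex Qx Qz x≤y y≤z , (d , desc , d∈ , λ n → ≤-trans (d≤x n) x≤y) , (u , asc , u∈ , λ n → ≤-trans y≤z (z≤u n))

  -- A descending sequence of infinite well-founded intervals spans a reversed ω-sum.
  NoFan : Set
  NoFan = (r : ℕ → A) → (∀ n → r (suc n) ≤ r n) →
    (∀ n → HasAsc (λ x → r (suc n) ≤ x × x ≤ r n)) → (∀ n → ¬ HasDesc (λ x → r (suc n) ≤ x × x ≤ r n)) → ⊥

  -- If no cut ends the process, right steps give a descending sequence `r`. Each interval between
  -- consecutive terms contains an ascending sequence, since the lower term is a source below the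
  -- upper one; a descending sequence in it would make the lower term a midpoint. This is a fan.
  exhaust-rightSteps : NoFan → ∀ Q → Convex Q → Sourced Q → NoMid Q →
    Σ[ Q′ ∈ Subset A ] Q′ ⊆ Q × Convex Q′ × Sourced Q′ × NoMid Q′ × ¬ Σ A (RightStep Q′)
  exhaust-rightSteps noFan Q convex sourced noMid with em (Σ A (RightStep Q))
  ... | no stuck = Q , id , convex , sourced , noMid , stuck
  ... | yes (r₁ , (Qr₁ , _) , sourced₁)
    with em (Σ[ r ∈ A ] Q r × Sourced (Q ↓ r) × ¬ Σ A (RightStep (Q ↓ r)))
  ...   | yes (r , Qr , sourced′ , stuck) =
    (Q ↓ r) , proj₁ , ↓-convex Q r convex , sourced′ , noMid-mono (Q ↓ r) Q proj₁ noMid , stuck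
  -- The first term is dropped: excluding descending sequences below `r (suc n)` uses the ascending
  -- sequence above it, which comes from the step at `n`.
  ...   | no unending = ⊥-elim (noFan (r ∘ suc) (λ n → descends (suc n)) ascending wellfounded)
    where
    State : Set
    State = Σ[ r ∈ A ] Q r × Sourced (Q ↓ r)
    next : (t : State) → Σ[ t′ ∈ State ] AscAbove (Q ↓ proj₁ t) (proj₁ t′)
    next (r , Qr , sourced′) with byContradiction (λ stuck → unending (r , Qr , sourced′ , stuck))
    ... | r′ , ((Qr′ , _) , _ , asc) , sourced″ =
      (r′ , Qr′ , sourced-mono ((Q ↓ r) ↓ r′) (Q ↓ r′) (λ ((q , _) , p) → q , p) sourced″) , asc
    steps : Σ[ s ∈ (ℕ → State) ] ∀ n → AscAbove (Q ↓ proj₁ (s n)) (proj₁ (s (suc n)))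
    steps = dependentChoice {R = λ t t′ → AscAbove (Q ↓ proj₁ t) (proj₁ t′)} next (r₁ , Qr₁ , sourced₁)
    r : ℕ → A
    r n = proj₁ (proj₁ steps n)
    Qr : r ⊑ Q
    Qr n = proj₁ (proj₂ (proj₁ steps n))
    descends : ∀ n → r (suc n) ≤ r n
    descends n with proj₂ steps n
    ... | u , _ , u∈ , r≤u = ≤-trans (r≤u 0) (proj₂ (u∈ 0))
    ascending : ∀ n → HasAsc (λ x → r (suc (suc n)) ≤ x × x ≤ r (suc n))
    ascending n with proj₂ steps (suc n)
    ... | u , asc , u∈ , r≤u = u , asc , λ k → r≤u k , proj₂ (u∈ k)
    wellfounded : ∀ n → ¬ HasDesc (λ x → r (suc (suc n)) ≤ x × x ≤ r (suc n))
    wellfounded n (v , desc , v∈) with proj₂ steps n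
    ... | u , asc , u∈ , r≤u = noMid (r (suc (suc n)) , Qr (suc (suc n)) , proj₂ (proj₂ (proj₁ steps (suc (suc n)))) ,
      r (suc n) , (Qr (suc n) , descends (suc n)) ,
      (v , desc , (λ k → convex (Qr (suc (suc n))) (Qr (suc n)) (proj₁ (v∈ k)) (proj₂ (v∈ k)) , proj₁ (v∈ k)) , λ k → proj₂ (v∈ k)) ,
      (u , asc , (λ k → proj₁ (u∈ k) , ≤-trans (descends (suc n)) (r≤u k)) , r≤u))

  -- An ascending sequence of sources between `a` and `b` makes `a` a source of the part below `b`,
  -- so `b` is a right step. A descending one makes `a` a left step.
  sources-locallyFinite : ∀ Q → ¬ Σ A (RightStep Q) → ¬ Σ A (LeftStep Q) → LocallyFinite (Source Q)
  sources-locallyFinite Q noRight noLeft {a} {b}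
    sa@(Qa , (d , desc , d∈ , d≤a) , _) sb@(Qb , _ , (u , asc , u∈ , b≤u)) = byContradiction contra
    where
    contra : ¬ Infinite (λ x → Source Q x × a ≤ x × x ≤ b)
    contra inf with infinite⇒monotone inf
    ... | inj₁ (w , asc-w , w∈) = noRight (b , sb , a , (Qa , a≤b) ,
      (d , desc , (λ n → d∈ n , ≤-trans (d≤a n) a≤b) , d≤a) ,
      (w , asc-w , (λ n → proj₁ (proj₁ (w∈ n)) , proj₂ (proj₂ (w∈ n))) , λ n → proj₁ (proj₂ (w∈ n))))
      where a≤b = ≤-trans (proj₁ (proj₂ (w∈ 0))) (proj₂ (proj₂ (w∈ 0)))
    ... | inj₂ (w , desc-w , w∈) = noLeft (a , sa , b , (Qb , a≤b) ,
      (w , desc-w , (λ n → proj₁ (proj₁ (w∈ n)) , proj₁ (proj₂ (w∈ n))) , λ n → proj₂ (proj₂ (w∈ n))) ,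
      (u , asc , (λ n → u∈ n , ≤-trans a≤b (b≤u n)) , b≤u))
      where a≤b = ≤-trans (proj₁ (proj₂ (w∈ 0))) (proj₂ (proj₂ (w∈ 0)))

  -- Safe chains

  open PosetNotions _≤_ public using (Chain)

  Beside : Subset A → A → Subset A
  Beside B b x = x ∥ b × Finite (λ b′ → B b′ × b′ ∥ x)

  SafeIn : Subset A → Subset A → Set
  SafeIn Q B = B ⊆ Q × Chain B × (∀ {b} → B b → Finite (λ x → Q x × Beside B b x))

  -- Late terms of `u` are comparable to `x`, and they cannot lie below `x` because they lie above
  -- `b`.
  asc-bounds : ∀ {B u b x n} → Asc u → u ⊑ B → b ≤ u n → Beside B b x → Σ[ m ∈ ℕ ] x ≤ u m
  asc-bounds {u = u} {b} {x} {n} asc u∈B b≤un (x∥b , fin) with eventually-leaves (asc-injective asc) fin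
  ... | N , out with compare (u (n + N)) x
  ...   | inj₁ u≤x        = ⊥-elim (∥⇒≱ x∥b (≤-trans b≤un (≤-trans (asc-≤ asc (ℕ.m≤m+n n N)) u≤x)))
  ...   | inj₂ (inj₁ x≤u) = n + N , x≤u
  ...   | inj₂ (inj₂ u∥x) = ⊥-elim (out (n + N) (ℕ.m≤n+m N n) (u∈B (n + N) , u∥x))

  beside-above-asc : ∀ {B s b x} → Asc s → s ⊑ B → (∀ n → s n ≤ b) → Beside B b x → Σ[ n ∈ ℕ ] s n ≤ x
  beside-above-asc {s = s} {x = x} asc s∈B s≤b (x∥b , fin) with eventually-leaves (asc-injective asc) fin
  ... | N , out with compare (s N) x
  ...   | inj₁ s≤x        = N , s≤x
  ...   | inj₂ (inj₁ x≤s) = ⊥-elim (∥⇒≰ x∥b (≤-trans x≤s (s≤b N)))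
  ...   | inj₂ (inj₂ s∥x) = ⊥-elim (out N ℕ.≤-refl (s∈B N , s∥x))

  -- Minimality speaks of sequences incomparable to a term `u n`, not to `b`. Local finiteness lets
  -- a tail of `y` escape from below `u n`, and `b ≤ u n` rules out the other comparison.
  no-asc-beside : ∀ {Z u b n} → LocallyFinite Z → u ⊑ Z → MinimalAsc Z u → b ≤ u n →
    (y : ℕ → A) → Asc y → y ⊑ Z → (∀ k → y k ∥ b) → (∀ k → Σ[ m ∈ ℕ ] y k ≤ u m) → ⊥
  no-asc-beside {n = n} lf u∈Z minimal b≤un y asc y∈Z y∥b y≤u with asc-escapes lf asc y∈Z (u∈Z n)
  ... | N , out = minimal n ((λ k → y (k + N)) , asc-drop asc N , (λ k → y∈Z (k + N)) ,
    (λ k → ≰≱⇒∥ (out (k + N) (ℕ.m≤n+m N k)) (λ un≤y → ∥⇒≱ (y∥b (k + N)) (≤-trans b≤un un≤y))) ,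
    λ k → y≤u (k + N))

  Initial : Subset A → Subset A
  Initial Q x = Q x × Finite (λ y → Q y × y ≤ x)

  initial-locallyFinite : ∀ {Q} → LocallyFinite (Initial Q)
  initial-locallyFinite _ (_ , fin) = finite-⊆ (λ x ((Qx , _) , _ , x≤b) → Qx , x≤b) fin

  -- Take `u` generating a minimal ideal of initial elements. What is beside `u n` lies below some
  -- `u m`, hence is again initial: an ascending sequence of such elements contradicts minimality, a
  -- descending one the finiteness of down-sets.
  safe-initial : ∀ {Q} → Infinite (Initial Q) → Σ[ B ∈ Subset A ] Σ A B × SafeIn Q B
  safe-initial {Q} inf with infinite⇒monotone inf
  ... | inj₂ (d , desc , d∈) = ⊥-elim (injective⇒infinite (Reversed.asc-injective desc)
    (λ n → proj₁ (d∈ n) , Reversed.asc-≤ desc z≤n) (proj₂ (d∈ 0)))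
  ... | inj₁ hasAsc with minimalAsc-exists (initial-locallyFinite {Q}) hasAsc
  ...   | u , asc , u∈ , minimal = B , (u 0 , 0 , refl) , (λ { (n , refl) → proj₁ (u∈ n) }) , chain , safe
    where
    B : Subset A
    B x = Σ[ n ∈ ℕ ] u n ≡ x
    chain : Chain B
    chain _ _ (m , refl) (n , refl) with ℕ.≤-total m n
    ... | inj₁ m≤n = inj₁ (asc-≤ asc m≤n)
    ... | inj₂ n≤m = inj₂ (asc-≤ asc n≤m)
    safe : ∀ {b} → B b → Finite (λ x → Q x × Beside B b x)
    safe (n , refl) = byContradiction contra
      where
      bounded : ∀ {x} → Beside B (u n) x → Σ[ m ∈ ℕ ] x ≤ u m
      bounded = asc-bounds asc (λ k → k , refl) (≤-refl {u n})
      initial : ∀ {x} → Q x → Beside B (u n) x → Initial Q x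
      initial Qx beside with bounded beside
      ... | m , x≤um = Qx , finite-⊆ (λ y (Qy , y≤x) → Qy , ≤-trans y≤x x≤um) (proj₂ (u∈ m))
      contra : ¬ Infinite (λ x → Q x × Beside B (u n) x)
      contra inf′ with infinite⇒monotone inf′
      ... | inj₁ (y , asc-y , y∈) = minimal n (y , asc-y , (λ k → initial (proj₁ (y∈ k)) (proj₂ (y∈ k))) ,
        (λ k → proj₁ (proj₂ (y∈ k))) , λ k → bounded (proj₂ (y∈ k)))
      ... | inj₂ (y , desc-y , y∈) = injective⇒infinite (Reversed.asc-injective desc-y)
        (λ k → proj₁ (y∈ k) , Reversed.asc-≤ desc-y z≤n) (proj₂ (initial (proj₁ (y∈ 0)) (proj₂ (y∈ 0))))

  -- A non-initial element has a smaller non-initial one, since otherwise its down-set would consist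
  -- of itself and finitely many initial elements.
  descend : ∀ {Q q} → Finite (Initial Q) → Q q → ¬ Initial Q q → DescBelow Q q
  descend {Q} {q} fin Qq notInitial =
    proj₁ ∘ s , (λ n → proj₁ (down n) , λ e → proj₂ (down n) (sym e)) , (λ n → proj₁ (proj₂ (s n))) , λ n → proj₂ (proj₂ (proj₂ (s n)))
    where
    State : Set
    State = Σ[ x ∈ A ] Q x × ¬ Initial Q x × x ≤ q
    next : (t : State) → Σ[ t′ ∈ State ] proj₁ t′ < proj₁ t
    next (x , Qx , ¬init , x≤q) = byContradiction λ none →
      ¬init (Qx , finite-⊆ (split none) (finite-∪ {S = _≡ x} (x ∷ [] , λ { _ refl → here refl }) fin))
      where
      split : ¬ (Σ[ t′ ∈ State ] proj₁ t′ < x) → ∀ y → Q y × y ≤ x → y ≡ x ⊎ Initial Q y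
      split none y (Qy , y≤x) with em (y ≡ x) | em (Initial Q y)
      ... | yes e | _        = inj₁ e
      ... | no _  | yes init = inj₂ init
      ... | no ne | no ¬init′ = ⊥-elim (none ((y , Qy , ¬init′ , ≤-trans y≤x x≤q) , y≤x , ne))
    chosen : Σ[ s ∈ (ℕ → State) ] ∀ n → proj₁ (s (suc n)) < proj₁ (s n)
    chosen = dependentChoice {R = λ t t′ → proj₁ t′ < proj₁ t} next (q , Qq , notInitial , ≤-refl)
    s = proj₁ chosen
    down = proj₂ chosen

  -- Such a y is incomparable to all of D between d and x; hence D has a greatest
  -- element below x, and y is beside it.
  lower-neighbours-finite : ∀ {D} → Chain D → (∀ {d} → D d → Finite (Beside D d)) → ∀ x b →
    (∀ {d} → D d → d ≤ x → d < b) →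
    Finite (λ y → Beside D b y × Σ[ d ∈ A ] D d × d ≤ x × ¬ d < y)
  lower-neighbours-finite {D} chain safe x b d<b
    with em (Σ[ t ∈ A ] D t × t ≤ x × (∀ {d} → D d → d ≤ x → d ≤ t))
  ... | yes (t , Dt , t≤x , top) = finite-⊆
    (λ y ((y∥b , fin) , d , Dd , d≤x , d≮y) → ∥-sym (between-∥ y∥b Dd d≤x d≮y Dt (top Dd d≤x) t≤x) , fin) (safe Dt)
    where
    between-∥ : ∀ {y d d′} → y ∥ b → D d → d ≤ x → ¬ d < y → D d′ → d ≤ d′ → d′ ≤ x → d′ ∥ y
    between-∥ y∥b Dd d≤x d≮y Dd′ d≤d′ d′≤x = ≰≱⇒∥
      (λ d′≤y → d≮y (≤-trans d≤d′ d′≤y , λ { refl → ∥⇒≰ y∥b (proj₁ (d<b Dd d≤x)) }))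
      (λ y≤d′ → ∥⇒≰ y∥b (≤-trans y≤d′ (proj₁ (d<b Dd′ d′≤x))))
  ... | no noTop = [] , λ y (beside , d , Dd , d≤x , d≮y) → ⊥-elim (impossible beside Dd d≤x d≮y)
    where
    impossible : ∀ {y d} → Beside D b y → D d → d ≤ x → ¬ d < y → ⊥
    impossible {y} {d} (y∥b , fin) Dd d≤x d≮y =
      asc-not-in-finite (proj₂ chosen) (λ n → proj₁ (proj₂ (s n)) , s∥y n) fin
      where
      State : Set
      State = Σ[ d′ ∈ A ] D d′ × d ≤ d′ × d′ ≤ x
      next : (t : State) → Σ[ t′ ∈ State ] proj₁ t < proj₁ t′
      next (d′ , Dd′ , d≤d′ , d′≤x) = byContradiction λ none → noTop (d′ , Dd′ , d′≤x , λ {e} De e≤x →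
        byContradiction λ e≰d′ → none ((e , De , ≤-trans d≤d′ (above De e≰d′) , e≤x) ,
          above De e≰d′ , λ { refl → e≰d′ ≤-refl }))
        where
        above : ∀ {e} → D e → ¬ e ≤ d′ → d′ ≤ e
        above De e≰d′ with chain _ _ De Dd′
        ... | inj₁ e≤d′ = ⊥-elim (e≰d′ e≤d′)
        ... | inj₂ d′≤e = d′≤e
      chosen : Σ[ s ∈ (ℕ → State) ] Asc (proj₁ ∘ s)
      chosen = dependentChoice {R = λ t t′ → proj₁ t < proj₁ t′} next (d , Dd , ≤-refl , d≤x)
      s = proj₁ chosen
      s∥y : ∀ n → proj₁ (s n) ∥ y
      s∥y n with s n
      ... | d′ , Dd′ , d≤d′ , d′≤x = ≰≱⇒∥
        (λ d′≤y → d≮y (≤-trans d≤d′ d′≤y , λ { refl → ∥⇒≰ y∥b (proj₁ (d<b Dd d≤x)) }))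
        (λ y≤d′ → ∥⇒≰ y∥b (≤-trans y≤d′ (proj₁ (d<b Dd′ d′≤x))))

  -- Fibres of a spine

  Thin : Subset A → Set
  Thin R = ∀ {x} → R x → Finite (λ y → R y × y ∥ x)

  -- A fibre is named by its representative `γ`, a fixed point of `f`. It is free for `x` when `x`
  -- can join it without spoiling the antichain.
  FreeFibre : Subset A → (A → A) → A → Subset A
  FreeFibre R f x γ = R γ × f γ ≡ γ × (∀ {y} → R y → f y ≡ γ → y ∥ x)

  -- The terms `c n` lie in distinct fibres, and no member of these fibres is above `x`. So a fibre
  -- that is not free has a member below `x`; if almost all had one, comparing them with `c 0` would
  -- give a contradiction.
  asc⇒infinitely-many-freeFibres : ∀ {R f x} → Thin R → (∀ {y} → R y → R (f y)) → (∀ {y} → R y → f (f y) ≡ f y) →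
    (∀ {y z} → R y → R z → f y ≡ f z → y ≤ z → y ≡ z) → HasAsc (λ c → R c × c ∥ x) → Infinite (FreeFibre R f x)
  asc⇒infinitely-many-freeFibres {R} {f} {x} thin closed idem fibre (c , asc , c∈) finFree = contra
    where
    γ : ℕ → A
    γ n = f (c n)
    Rc : c ⊑ R
    Rc n = proj₁ (c∈ n)
    Rγ : γ ⊑ R
    Rγ n = closed (Rc n)
    γ-injective : Injectiveℕ γ
    γ-injective {i} {j} e with ℕ.≤-total i j
    ... | inj₁ i≤j = asc-injective asc (fibre (Rc i) (Rc j) e (asc-≤ asc i≤j))
    ... | inj₂ j≤i = sym (asc-injective asc (fibre (Rc j) (Rc i) (sym e) (asc-≤ asc j≤i)))
    N = proj₁ (eventually-leaves γ-injective finFree)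

    c≰γ : ∀ {n m} → n <ₙ m → ¬ c m ≤ γ n
    c≰γ {n} n<m cm≤γ = <⇒≱ (asc-< asc n<m) (subst (c _ ≤_) (sym cn≡γ) cm≤γ)
      where
      cn≡γ : c n ≡ γ n
      cn≡γ = fibre (Rc n) (Rγ n) (sym (idem (Rc n))) (≤-trans (asc-≤ asc (ℕ.<⇒≤ n<m)) cm≤γ)

    x≰fibre : ∀ n {y} → R y → f y ≡ γ n → ¬ x ≤ y
    x≰fibre n {y} Ry fy≡γ x≤y
      with eventually-leaves (asc-injective asc) (thin (Rγ n)) | eventually-leaves (asc-injective asc) (thin Ry)
    -- By thinness a late `c m` is comparable to `γ n` and to `y`, and then lies above both; so
    -- `x ≤ y` would put `x` below `c m`.
    ... | N₁ , out₁ | N₂ , out₂ = ∥⇒≱ (proj₂ (c∈ m)) (≤-trans x≤y y≤c)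
      where
      m = suc n + (N₁ + N₂)
      n<m : n <ₙ m
      n<m = ℕ.m≤m+n (suc n) (N₁ + N₂)
      γ≤c : γ n ≤ c m
      γ≤c with compare (c m) (γ n)
      ... | inj₁ c≤γ        = ⊥-elim (c≰γ n<m c≤γ)
      ... | inj₂ (inj₁ γ≤c) = γ≤c
      ... | inj₂ (inj₂ c∥γ) = ⊥-elim (out₁ m (ℕ.≤-trans (ℕ.m≤m+n N₁ N₂) (ℕ.m≤n+m _ (suc n))) (Rc m , c∥γ))
      y≤c : y ≤ c m
      y≤c with compare (c m) y
      ... | inj₁ c≤y        = ⊥-elim (c≰γ n<m (subst (c m ≤_) (sym γ≡y) c≤y))
        where
        γ≡y : γ n ≡ y
        γ≡y = fibre (Rγ n) Ry (trans (idem (Rc n)) (sym fy≡γ)) (≤-trans γ≤c c≤y)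
      ... | inj₂ (inj₁ y≤c) = y≤c
      ... | inj₂ (inj₂ c∥y) = ⊥-elim (out₂ m (ℕ.≤-trans (ℕ.m≤n+m N₂ N₁) (ℕ.m≤n+m _ (suc n))) (Rc m , c∥y))

    obstruction : ∀ k → Σ[ y ∈ A ] R y × f y ≡ γ (k + N) × y ≤ x
    obstruction k = byContradiction λ none →
      proj₂ (eventually-leaves γ-injective finFree) (k + N) (ℕ.m≤n+m N k)
        (Rγ (k + N) , idem (Rc (k + N)) , λ {y} Ry e → ≰≱⇒∥ (λ y≤x → none (y , Ry , e , y≤x)) (x≰fibre (k + N) Ry e))
    y : ℕ → A
    y k = proj₁ (obstruction k)
    Ry : y ⊑ R
    Ry k = proj₁ (proj₂ (obstruction k))
    fy : ∀ k → f (y k) ≡ γ (k + N)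
    fy k = proj₁ (proj₂ (proj₂ (obstruction k)))
    y≤x : ∀ k → y k ≤ x
    y≤x k = proj₂ (proj₂ (proj₂ (obstruction k)))
    y-injective : Injectiveℕ y
    y-injective {i} {j} e = ℕ.+-cancelʳ-≡ N i j (γ-injective (trans (sym (fy i)) (trans (cong f e) (fy j))))

    contra : ⊥
    contra with eventually-leaves y-injective (thin (Rc 0)) | eventually-leaves γ-injective (thin (Rc 0))
    -- Far out, `y k` and `γ (k + N)` are comparable to `c 0`, and `y k ≤ c 0` because `y k ≤ x`. If
    -- `γ (k + N)` is below `c 0` it equals `c (k + N)`, if above it equals `y k`; both are absurd.
    -- The `suc` in `k` makes `c 0 < c (k + N)` strict.
    ... | N₁ , out₁ | N₂ , out₂ = impossible (compare (y k) (c 0)) (compare (γ (k + N)) (c 0))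
      where
      k = suc (N₁ + N₂)
      c₀≰x : ∀ {z} → z ≤ x → ¬ c 0 ≤ z
      c₀≰x z≤x c≤z = ∥⇒≰ (proj₂ (c∈ 0)) (≤-trans c≤z z≤x)
      impossible : y k ≤ c 0 ⊎ c 0 ≤ y k ⊎ y k ∥ c 0 → γ (k + N) ≤ c 0 ⊎ c 0 ≤ γ (k + N) ⊎ γ (k + N) ∥ c 0 → ⊥
      impossible (inj₂ (inj₁ c≤y)) _ = c₀≰x (y≤x k) c≤y
      impossible (inj₂ (inj₂ y∥c)) _ = out₁ k (ℕ.m≤n⇒m≤1+n (ℕ.m≤m+n N₁ N₂)) (Ry k , y∥c)
      impossible (inj₁ _) (inj₂ (inj₂ γ∥c)) =
        out₂ (k + N) (ℕ.≤-trans (ℕ.m≤n⇒m≤1+n (ℕ.m≤n+m N₂ N₁)) (ℕ.m≤m+n k N)) (Rγ (k + N) , γ∥c)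
      impossible (inj₁ _) (inj₁ γ≤c) = <⇒≱ (asc-< asc (s≤s z≤n)) (subst (_≤ c 0) γ≡c γ≤c)
        where
        γ≡c : γ (k + N) ≡ c (k + N)
        γ≡c = fibre (Rγ (k + N)) (Rc (k + N)) (idem (Rc (k + N))) (≤-trans γ≤c (asc-≤ asc z≤n))
      impossible (inj₁ y≤c) (inj₂ (inj₁ c≤γ)) = c₀≰x (y≤x k) (subst (c 0 ≤_) (sym y≡γ) c≤γ)
        where
        y≡γ : y k ≡ γ (k + N)
        y≡γ = fibre (Ry k) (Rγ (k + N)) (trans (fy k) (sym (idem (Rc (k + N))))) (≤-trans y≤c c≤γ)

  -- From fans to contiguous reversed ω-sums

  open PosetNotions _≤_ using (Contiguous; OmegaSum; Reverse)

  least : {P : Subset ℕ} → ∀ n → P n → Σ[ m ∈ ℕ ] P m × (∀ k → k <ₙ m → ¬ P k)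
  least {P} = <-rec (λ n → P n → Σ[ m ∈ ℕ ] P m × (∀ k → k <ₙ m → ¬ P k)) search
    where
    search : ∀ n → (∀ {k} → k <ₙ n → P k → Σ[ m ∈ ℕ ] P m × (∀ k → k <ₙ m → ¬ P k)) →
      P n → Σ[ m ∈ ℕ ] P m × (∀ k → k <ₙ m → ¬ P k)
    search n rec Pn with em (Σ[ k ∈ ℕ ] k <ₙ n × P k)
    ... | yes (k , k<n , Pk) = rec k<n Pk
    ... | no none            = n , Pn , λ k k<n Pk → none (k , k<n , Pk)

  -- The endpoints `r n` and the ascending sequences form a chain. A maximal chain containing it
  -- among the elements between some `r n` and `r 0` is contiguous, and the points `r n` cut it into
  -- infinite blocks without descending sequences.
  noFan : (∀ C → Chain C → Contiguous C → ¬ OmegaSum (Reverse _<_) C) → NoFan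
  noFan noSum r r-step ascending wellfounded = noSum (C ∋_) C-chain contiguous (g , ordered , blocks)
    where
    r-anti : ∀ {m n} → m ≤ₙ n → r n ≤ r m
    r-anti {zero} {zero} z≤n = ≤-refl
    r-anti {m} {suc n} m≤1+n with ℕ.m≤n⇒m<n∨m≡n m≤1+n
    ... | inj₁ m<1+n = ≤-trans (r-step n) (r-anti (ℕ.m<1+n⇒m≤n m<1+n))
    ... | inj₂ refl  = ≤-refl
    s : ℕ → ℕ → A
    s n = proj₁ (ascending n)
    s-asc : ∀ n → Asc (s n)
    s-asc n = proj₁ (proj₂ (ascending n))
    s-in : ∀ n k → r (suc n) ≤ s n k × s n k ≤ r n
    s-in n = proj₂ (proj₂ (ascending n))
    r-strict : ∀ n → r (suc n) < r n
    r-strict n = ≤-<-trans (proj₁ (s-in n 0)) (<-≤-trans (s-asc n 0) (proj₂ (s-in n 1)))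

    At Mark : ℕ → Subset A
    At n x   = r (suc n) ≤ x × x ≤ r n
    Mark n x = x ≡ r n ⊎ (Σ[ k ∈ ℕ ] x ≡ s n k)
    mark-at : ∀ {n x} → Mark n x → At n x
    mark-at {n} (inj₁ refl)       = r-step n , ≤-refl
    mark-at {n} (inj₂ (k , refl)) = s-in n k
    same-block : ∀ {n x y} → Mark n x → Mark n y → x ≤ y ⊎ y ≤ x
    same-block (inj₁ refl) my = inj₂ (proj₂ (mark-at my))
    same-block mx (inj₁ refl) = inj₁ (proj₂ (mark-at mx))
    same-block {n} (inj₂ (k , refl)) (inj₂ (l , refl)) with ℕ.≤-total k l
    ... | inj₁ k≤l = inj₁ (asc-≤ (s-asc n) k≤l)
    ... | inj₂ l≤k = inj₂ (asc-≤ (s-asc n) l≤k)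
    Marks Between : Subset A
    Marks x   = Σ[ n ∈ ℕ ] Mark n x
    Between x = (Σ[ n ∈ ℕ ] r n ≤ x) × x ≤ r 0
    marks-chain : Chain Marks
    marks-chain x y (m , mx) (n , my) with ℕ.<-cmp m n
    ... | tri< m<n _ _ = inj₂ (≤-trans (proj₂ (mark-at my)) (≤-trans (r-anti m<n) (proj₁ (mark-at mx))))
    ... | tri≈ _ refl _ = same-block mx my
    ... | tri> _ _ n<m = inj₁ (≤-trans (proj₂ (mark-at mx)) (≤-trans (r-anti n<m) (proj₁ (mark-at my))))
    marks-between : Marks ⊆ Between
    marks-between (n , mx) = (suc n , proj₁ (mark-at mx)) , ≤-trans (proj₂ (mark-at mx)) (r-anti z≤n)

    Filling : Sub → Set
    Filling E = Chain (E ∋_) × (∀ {x} → E ∋ x → Between x)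
    filling-closed : ∀ t → (∀ n → Filling (t n)) → Increasing t → Filling ⟦ ⋃ t ⟧
    filling-closed t fill inc = chain , λ {x} Ex → between (∋⁻ {⋃ t} Ex)
      where
      between : ∀ {x} → ⋃ t x → Between x
      between (n , tx) = proj₂ (fill n) tx
      chain : Chain (⟦ ⋃ t ⟧ ∋_)
      chain x y Ex Ey with common-stage inc (∋⁻ {⋃ t} Ex) (∋⁻ {⋃ t} Ey)
      ... | n , tx , ty = proj₁ (fill n) x y tx ty
    marks-filling : Filling ⟦ Marks ⟧
    marks-filling = (λ x y Ex Ey → marks-chain x y (∋⁻ {Marks} Ex) (∋⁻ {Marks} Ey)) , λ Ex → marks-between (∋⁻ {Marks} Ex)
    maximal-filling : Σ[ D ∈ Sub ] Filling D × (∀ {x} → ⟦ Marks ⟧ ∋ x → D ∋ x) × Maximal Filling D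
    maximal-filling = zorn Filling filling-closed marks-filling
    C : Sub
    C = proj₁ maximal-filling
    C-chain : Chain (C ∋_)
    C-chain = proj₁ (proj₁ (proj₂ maximal-filling))
    C-between : ∀ {x} → C ∋ x → Between x
    C-between = proj₂ (proj₁ (proj₂ maximal-filling))
    C-marks : ∀ {x} → Marks x → C ∋ x
    C-marks m = proj₁ (proj₂ (proj₂ maximal-filling)) (∋⁺ {Marks} m)
    r∈C : ∀ n → C ∋ r n
    r∈C n = C-marks (n , inj₁ refl)

    contiguous : Contiguous (C ∋_)
    contiguous x y z x∉C y∈C z∈C y<x x<z comparable =
      x∉C (proj₂ (proj₂ (proj₂ maximal-filling)) (chain , between) (λ Cw → ∋⁺ {C∪x} (inj₁ Cw)) (∋⁺ {C∪x} (inj₂ refl)))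
      where
      C∪x : Subset A
      C∪x w = C ∋ w ⊎ w ≡ x
      chain : Chain (⟦ C∪x ⟧ ∋_)
      chain v w Ev Ew with ∋⁻ {C∪x} Ev | ∋⁻ {C∪x} Ew
      ... | inj₁ Cv   | inj₁ Cw   = C-chain v w Cv Cw
      ... | inj₁ Cv   | inj₂ refl = comparable v Cv
      ... | inj₂ refl | inj₂ refl = inj₁ ≤-refl
      ... | inj₂ refl | inj₁ Cw with comparable w Cw
      ...   | inj₁ w≤x = inj₂ w≤x
      ...   | inj₂ x≤w = inj₁ x≤w
      between : ∀ {w} → ⟦ C∪x ⟧ ∋ w → Between w
      between Ew with ∋⁻ {C∪x} Ew
      ... | inj₁ Cw = C-between Cw
      ... | inj₂ refl with C-between y∈C | C-between z∈C
      ...   | (n , r≤y) , _ | _ , z≤r = (n , ≤-trans r≤y (proj₁ y<x)) , ≤-trans (proj₁ x<z) z≤r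

    -- Within `C`, block `n` runs from `r (suc n)`, excluded, to `r n`, included, so each endpoint
    -- belongs to exactly one block.
    Block : A → ℕ → Set
    Block x n = r (suc n) < x × (∀ k → k <ₙ n → ¬ r (suc k) < x)
    block-exists : ∀ {x} → C ∋ x → Σ ℕ (Block x)
    block-exists Cx with C-between Cx
    ... | (n , r≤x) , _ = least n (<-≤-trans (r-strict n) r≤x)
    block-unique : ∀ {x m n} → Block x m → Block x n → m ≡ n
    block-unique {m = m} {n} (above , first) (above′ , first′) with ℕ.<-cmp m n
    ... | tri< m<n _ _ = ⊥-elim (first′ m m<n above)
    ... | tri≈ _ m≡n _ = m≡n
    ... | tri> _ _ n<m = ⊥-elim (first n n<m above′)
    g : A → ℕ
    g x with em (Σ ℕ (Block x))
    ... | yes (n , _) = n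
    ... | no _        = 0
    g-block : ∀ {x} → C ∋ x → Block x (g x)
    g-block {x} Cx with em (Σ ℕ (Block x))
    ... | yes (_ , block) = block
    ... | no none         = ⊥-elim (none (block-exists Cx))

    below : ∀ {x n} → C ∋ x → ¬ r n < x → x ≤ r n
    below {x} {n} Cx r≮x with C-chain x (r n) Cx (r∈C n)
    ... | inj₁ x≤r = x≤r
    ... | inj₂ r≤x = byContradiction λ x≰r → r≮x (r≤x , λ { refl → x≰r ≤-refl })
    ordered : ∀ x y → C ∋ x → C ∋ y → g x <ₙ g y → Reverse _<_ x y
    ordered x y Cx Cy gx<gy =
      ≤-<-trans (below Cy (proj₂ (g-block Cy) (g x) gx<gy)) (proj₁ (g-block Cx))
    in-block : ∀ {x} n → C ∋ x → g x ≡ n → At n x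
    in-block zero Cx gx≡n with g-block Cx
    ... | above , _ = subst (λ i → r (suc i) ≤ _) gx≡n (proj₁ above) , proj₂ (C-between Cx)
    in-block (suc n) Cx gx≡n with g-block Cx
    ... | above , first = subst (λ i → r (suc i) ≤ _) gx≡n (proj₁ above) ,
      below Cx (first n (subst (n <ₙ_) (sym gx≡n) (ℕ.n<1+n n)))
    blocks : ∀ n → Infinite (λ x → C ∋ x × g x ≡ n) × PosetNotions.CoWellfounded _≤_ (Reverse _<_) (λ x → C ∋ x × g x ≡ n)
    -- The first term of `s n` is dropped because it may equal `r (suc n)`, which belongs to the
    -- next block.
    blocks n = asc-not-in-finite (asc-drop (s-asc n) 1) (λ k → Cs k , block-unique (g-block (Cs k)) (s-block k)) ,
      λ (f , f∈ , f↓) → wellfounded n (f , (λ k → proj₁ (f↓ k) , λ e → proj₂ (f↓ k) (sym e)) ,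
        λ k → in-block n (proj₁ (f∈ k)) (proj₂ (f∈ k)))
      where
      Cs : ∀ k → C ∋ s n (k + 1)
      Cs k = C-marks (n , inj₂ (k + 1 , refl))
      s-block : ∀ k → Block (s n (k + 1)) n
      s-block k = ≤-<-trans (proj₁ (s-in n 0)) (asc-< (s-asc n) (ℕ.m≤n+m 1 k)) ,
        λ j j<n r<s → <⇒≱ r<s (≤-trans (proj₂ (s-in n (k + 1))) (r-anti j<n))

module Vacillating (em : ExcludedMiddle) {A : Set} (_≤_ : A → A → Set) (po : IsPartialOrder _≡_ _≤_)
  (code : A → ℕ) (code-injective : Injective _≡_ _≡_ code)
  (noInfiniteAntichain : PosetNotions.NoInfiniteAntichain _≤_)
  (vacillating : PosetNotions.Vacillating _≤_)
  where

  -- Duality and the removal of steps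

  _∥_ : A → A → Set
  x ∥ y = ¬ x ≤ y × ¬ y ≤ x

  ∥⇒≰ : ∀ {x y} → x ∥ y → ¬ x ≤ y
  ∥⇒≰ = proj₁

  ∥⇒≱ : ∀ {x y} → x ∥ y → ¬ y ≤ x
  ∥⇒≱ = proj₂

  ≰≱⇒∥ : ∀ {x y} → ¬ x ≤ y → ¬ y ≤ x → x ∥ y
  ≰≱⇒∥ = _,_

  ≱≰⇒∥ : ∀ {x y} → ¬ y ≤ x → ¬ x ≤ y → x ∥ y
  ≱≰⇒∥ p q = q , p

  open Classical em
  open Zorn em code code-injective
  open Sequences _≤_ po

  antichain-finite : (S : Subset A) → (∀ x y → S x → S y → x ≢ y → x ∥ y) → Finite S
  antichain-finite S anti = byContradiction (noInfiniteAntichain S λ x y Sx Sy x≤y →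
    byContradiction λ x≢y → ∥⇒≰ (anti x y Sx Sy x≢y) x≤y)

  open Order em _≤_ po _∥_ ∥⇒≰ ∥⇒≱ ≰≱⇒∥ antichain-finite code code-injective
  module Op = Order em (flip _≤_) (flip-isPartialOrder po) _∥_ ∥⇒≱ ∥⇒≰ ≱≰⇒∥ antichain-finite code code-injective

  noFan↓ : NoFan
  noFan↓ = noFan λ C chain contiguous → proj₂ (vacillating C chain contiguous)

  -- A reversed ω-sum of the reversed order is an ω-sum of the order itself, and contiguity is
  -- self-dual with the two bounds exchanged.
  noFan↑ : Op.NoFan
  noFan↑ = Op.noFan λ C chain contiguous (g , ordered , blocks) →
    proj₁ (vacillating C (λ x y Cx Cy → chain y x Cy Cx)
      (λ x y z x∉C Cy Cz (y≤x , y≢x) (x≤z , x≢z) comparable →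
        contiguous x z y x∉C Cz Cy (x≤z , λ e → x≢z (sym e)) (y≤x , λ e → y≢x (sym e)) (λ c Cc → swap (comparable c Cc))))
      (g , (λ x y Cx Cy gx<gy → proj₁ (ordered x y Cx Cy gx<gy) , λ e → proj₂ (ordered x y Cx Cy gx<gy) (sym e)) ,
       λ i → proj₁ (blocks i) , λ (f , f∈ , f↑) →
         proj₂ (blocks i) (f , f∈ , λ n → proj₁ (f↑ n) , λ e → proj₂ (f↑ n) (sym e)))

  op-source : ∀ {Q z} → Source Q z → Op.Source Q z
  op-source (Qz , desc , asc) = Qz , asc , desc

  op-sourced : ∀ Q → Sourced Q → Op.Sourced Q
  op-sourced Q (z , Qz , desc , asc) = z , Qz , asc , desc

  unop-sourced : ∀ Q → Op.Sourced Q → Sourced Q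
  unop-sourced Q (z , Qz , asc , desc) = z , Qz , desc , asc

  exhaust-leftSteps : ∀ Q → Convex Q → Sourced Q → NoMid Q →
    Σ[ Q′ ∈ Subset A ] Q′ ⊆ Q × Convex Q′ × Sourced Q′ × ¬ Σ A (LeftStep Q′)
  exhaust-leftSteps Q convex sourced noMid = unop (Op.exhaust-rightSteps noFan↑ Q
    (λ Qx Qz y≤x z≤y → convex Qz Qx z≤y y≤x) (op-sourced Q sourced)
    (λ (z , Qz , upper , lower) → noMid (z , Qz , unop-sourced (Q ↓ z) lower , unop-sourced (Q ↑ z) upper)))
    where
    unop : Σ[ Q′ ∈ Subset A ] Q′ ⊆ Q × Op.Convex Q′ × Op.Sourced Q′ × Op.NoMid Q′ × ¬ Σ A (Op.RightStep Q′) →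
      Σ[ Q′ ∈ Subset A ] Q′ ⊆ Q × Convex Q′ × Sourced Q′ × ¬ Σ A (LeftStep Q′)
    unop (Q′ , Q′⊆Q , convex′ , sourced′ , _ , noStep) =
      Q′ , Q′⊆Q , (λ Qx Qz x≤y y≤z → convex′ Qz Qx y≤z x≤y) , unop-sourced Q′ sourced′ ,
      λ (l , (Ql , desc , asc) , upper) → noStep (l , (Ql , asc , desc) , op-sourced (Q′ ↑ l) upper)

  -- Right steps are removed first and left steps second. Shrinking the set creates no new right
  -- steps, by `rightStep-mono`.
  exhaust-steps : ∀ Q → Convex Q → Sourced Q → NoMid Q →
    Σ[ Q′ ∈ Subset A ] Q′ ⊆ Q × Convex Q′ × Sourced Q′ × LocallyFinite (Source Q′)
  exhaust-steps Q convex sourced noMid =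
    case exhaust-rightSteps noFan↓ Q convex sourced noMid of λ (Q₁ , Q₁⊆Q , convex₁ , sourced₁ , noMid₁ , noRight) →
    combine Q₁ Q₁⊆Q noRight (exhaust-leftSteps Q₁ convex₁ sourced₁ noMid₁)
    where
    combine : ∀ Q₁ → Q₁ ⊆ Q → ¬ Σ A (RightStep Q₁) →
      Σ[ Q′ ∈ Subset A ] Q′ ⊆ Q₁ × Convex Q′ × Sourced Q′ × ¬ Σ A (LeftStep Q′) →
      Σ[ Q′ ∈ Subset A ] Q′ ⊆ Q × Convex Q′ × Sourced Q′ × LocallyFinite (Source Q′)
    combine Q₁ Q₁⊆Q noRight (Q₂ , Q₂⊆Q₁ , convex₂ , sourced₂ , noLeft) =
      Q₂ , (λ q → Q₁⊆Q (Q₂⊆Q₁ q)) , convex₂ , sourced₂ ,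
      sources-locallyFinite Q₂ (λ (r , step) → noRight (r , rightStep-mono Q₂ Q₁ Q₂⊆Q₁ step)) noLeft

  -- Safe chains of type ℤ

  GloballySafe : Subset A → Subset A → Set
  GloballySafe Q B = B ⊆ Q × Chain B × (∀ {b} → B b → Finite (Beside B b))

  SafeChain : Subset A → Set₁
  SafeChain Q = Σ[ B ∈ Subset A ] Σ A B × SafeIn Q B

  -- The ideal that `u` generates in `Z`. The descending half of the chain is minimal among
  -- sequences inside it, which suffices because all elements beside the chain are sources in this
  -- ideal.
  BelowSeq : Subset A → (ℕ → A) → Subset A
  BelowSeq Z u x = Z x × Σ[ m ∈ ℕ ] x ≤ u m

  below-locallyFinite : ∀ {Z u} → LocallyFinite Z → Op.LocallyFinite (BelowSeq Z u)
  below-locallyFinite lf (Za , _) (Zb , _) = finite-⊆ (λ x ((Zx , _) , x≤a , b≤x) → Zx , b≤x , x≤a) (lf Zb Za)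

  -- The descending d followed by the ascending u is a chain of order type ℤ. It has no ends, so an
  -- element incomparable to only finitely many of its members is bounded by it on both sides.
  two-ended-safe : ∀ Q → Convex Q → LocallyFinite (Source Q) → ∀ {u d m} →
    Asc u → u ⊑ Source Q → MinimalAsc (Source Q) u →
    Desc d → d ⊑ BelowSeq (Source Q) u → Op.MinimalAsc (BelowSeq (Source Q) u) d → d 0 ≤ u m →
    Σ[ B ∈ Subset A ] Σ A B × GloballySafe Q B
  two-ended-safe Q convex lf {u} {d} {m} asc u∈ minimal desc d∈ minimal′ d₀≤um =
    B , (d 0 , inj₁ (0 , refl)) , B⊆Q , chain , safe
    where
    u′ : ℕ → A
    u′ n = u (n + m)
    B : Subset A
    B x = (Σ[ n ∈ ℕ ] d n ≡ x) ⊎ (Σ[ n ∈ ℕ ] u′ n ≡ x)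
    B⊆Q : B ⊆ Q
    B⊆Q (inj₁ (n , refl)) = proj₁ (proj₁ (d∈ n))
    B⊆Q (inj₂ (n , refl)) = proj₁ (u∈ (n + m))
    d≤um : ∀ n → d n ≤ u m
    d≤um n = ≤-trans (Reversed.asc-≤ desc z≤n) d₀≤um
    d≤u′ : ∀ k n → d k ≤ u′ n
    d≤u′ k n = ≤-trans (d≤um k) (asc-≤ asc (ℕ.m≤n+m m n))
    chain : Chain B
    chain _ _ (inj₁ (k , refl)) (inj₂ (l , refl)) = inj₁ (d≤u′ k l)
    chain _ _ (inj₂ (k , refl)) (inj₁ (l , refl)) = inj₂ (d≤u′ l k)
    chain _ _ (inj₁ (k , refl)) (inj₁ (l , refl)) with ℕ.≤-total k l
    ... | inj₁ k≤l = inj₂ (Reversed.asc-≤ desc k≤l)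
    ... | inj₂ l≤k = inj₁ (Reversed.asc-≤ desc l≤k)
    chain _ _ (inj₂ (k , refl)) (inj₂ (l , refl)) with ℕ.≤-total k l
    ... | inj₁ k≤l = inj₁ (asc-≤ (asc-drop asc m) k≤l)
    ... | inj₂ l≤k = inj₂ (asc-≤ (asc-drop asc m) l≤k)
    above : ∀ {b} → B b → Σ[ n ∈ ℕ ] b ≤ u′ n
    above (inj₁ (k , refl)) = 0 , d≤um k
    above (inj₂ (k , refl)) = k , ≤-refl
    below : ∀ {b} → B b → Σ[ n ∈ ℕ ] d n ≤ b
    below (inj₁ (k , refl)) = k , ≤-refl
    below (inj₂ (k , refl)) = 0 , d≤u′ 0 k
    upper : ∀ {b x} → B b → Beside B b x → Σ[ n ∈ ℕ ] x ≤ u n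
    upper Bb beside with asc-bounds {n = proj₁ (above Bb)} (asc-drop asc m) (λ n → inj₂ (n , refl)) (proj₂ (above Bb)) beside
    ... | n , x≤u = n + m , x≤u
    lower : ∀ {b x} → B b → Beside B b x → Σ[ n ∈ ℕ ] d n ≤ x
    lower Bb beside = Op.asc-bounds {n = proj₁ (below Bb)} desc (λ n → inj₁ (n , refl)) (proj₂ (below Bb)) beside
    source : ∀ {b x} → B b → Beside B b x → Source Q x
    source Bb beside = source-convex Q convex (proj₁ (d∈ (proj₁ (lower Bb beside)))) (u∈ (proj₁ (upper Bb beside)))
      (proj₂ (lower Bb beside)) (proj₂ (upper Bb beside))
    safe : ∀ {b} → B b → Finite (Beside B b)
    safe {b} Bb = byContradiction contra
      where
      contra : ¬ Infinite (Beside B b)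
      contra inf with infinite⇒monotone inf
      ... | inj₁ (y , asc-y , y∈) = no-asc-beside lf u∈ minimal (proj₂ (above Bb)) y asc-y
        (λ k → source Bb (y∈ k)) (λ k → proj₁ (y∈ k)) (λ k → upper Bb (y∈ k))
      ... | inj₂ (y , desc-y , y∈) = Op.no-asc-beside (below-locallyFinite lf) d∈ minimal′ (proj₂ (below Bb)) y desc-y
        (λ k → source Bb (y∈ k) , upper Bb (y∈ k)) (λ k → proj₁ (y∈ k)) (λ k → lower Bb (y∈ k))

  safe-sourced : ∀ Q → Convex Q → LocallyFinite (Source Q) → Sourced Q → Σ[ B ∈ Subset A ] Σ A B × GloballySafe Q B
  safe-sourced Q convex lf (z , source) =
    case sources-ascend Q source of λ (s , asc-s , s∈ , _) →
    case minimalAsc-exists lf (s , asc-s , s∈) of λ (u , asc , u∈ , minimal) →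
    case Op.sources-ascend Q (op-source {Q} (u∈ 0)) of λ (t , desc-t , t∈ , t≤u₀) →
    case Op.minimalAsc-exists {BelowSeq (Source Q) u} (below-locallyFinite lf)
      (t , desc-t , λ n → (proj₁ (t∈ n) , proj₂ (proj₂ (t∈ n)) , proj₁ (proj₂ (t∈ n))) , 0 , t≤u₀ n)
    of λ (d , desc , d∈ , minimal′) →
    two-ended-safe Q convex lf asc u∈ minimal desc d∈ minimal′ (proj₂ (proj₂ (d∈ 0)))

  -- Scattered sets

  DenseChain : Subset A → Sub → Set
  DenseChain Q D = (∀ {x} → D ∋ x → Q x) × Chain (D ∋_) ×
    (∀ {x y} → D ∋ x → D ∋ y → x < y → Σ[ z ∈ A ] D ∋ z × x < z × z < y)

  -- Two distinct comparable points are demanded, since one-point chains are dense vacuously.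
  HasDense Scattered : Subset A → Set
  HasDense Q  = Σ[ D ∈ Sub ] DenseChain Q D × Σ[ x ∈ A ] Σ[ y ∈ A ] D ∋ x × D ∋ y × x < y
  Scattered Q = ¬ HasDense Q

  module Separation (Q : Subset A) where

    -- The interval of `Q` from `x` to `y`, taken by itself, has a source. A `t` with `x ⊲ t` and
    -- `t ⊲ y` is exactly a midpoint of that interval in the sense of `NoMid`.
    _⊲_ : A → A → Set
    x ⊲ y = Q x × Q y × x ≤ y × Sourced ((Q ↑ x) ↓ y)

    ⊲⇒< : ∀ {x y} → x ⊲ y → x < y
    ⊲⇒< (_ , _ , _ , z , _ , _ , (u , asc , u∈ , _)) =
      ≤-<-trans (proj₂ (proj₁ (u∈ 0))) (<-≤-trans (asc 0) (proj₂ (u∈ 1)))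

    ≤-⊲-trans : ∀ {x y z} → Q x → x ≤ y → y ⊲ z → x ⊲ z
    ≤-⊲-trans {x} {y} {z} Qx x≤y (_ , Qz , y≤z , sourced) = Qx , Qz , ≤-trans x≤y y≤z ,
      sourced-mono ((Q ↑ y) ↓ z) ((Q ↑ x) ↓ z) (λ ((q , y≤) , p) → (q , ≤-trans x≤y y≤) , p) sourced

    ⊲-≤-trans : ∀ {x y z} → Q z → x ⊲ y → y ≤ z → x ⊲ z
    ⊲-≤-trans {x} {y} {z} Qz (Qx , _ , x≤y , sourced) y≤z = Qx , Qz , ≤-trans x≤y y≤z ,
      sourced-mono ((Q ↑ x) ↓ y) ((Q ↑ x) ↓ z) (λ (q , p) → q , ≤-trans p y≤z) sourced

    -- Take a maximal chain for `⊲` through `p` and `q`. If `x < y` were adjacent in it, a `z` with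
    -- `x ⊲ z` and `z ⊲ y` would be related to all its members, each of which is below `x` or above
    -- `y`, and so would belong to it.
    ⊲-dense⇒HasDense : (∀ {x y} → x ⊲ y → Σ[ z ∈ A ] x ⊲ z × z ⊲ y) → ∀ {p q} → p ⊲ q → HasDense Q
    ⊲-dense⇒HasDense dense {p} {q} p⊲q =
      D , (D⊆Q , (λ x y Dx Dy → ⊲-chain⇒chain (D-chain Dx Dy)) , D-dense) , p , q , D-pair (inj₁ refl) , D-pair (inj₂ refl) , ⊲⇒< p⊲q
      where
      _~_ : A → A → Set
      x ~ y = x ≡ y ⊎ x ⊲ y ⊎ y ⊲ x
      ⊲-chain⇒chain : ∀ {x y} → x ~ y → x ≤ y ⊎ y ≤ x
      ⊲-chain⇒chain (inj₁ refl)       = inj₁ ≤-refl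
      ⊲-chain⇒chain (inj₂ (inj₁ x⊲y)) = inj₁ (proj₁ (⊲⇒< x⊲y))
      ⊲-chain⇒chain (inj₂ (inj₂ y⊲x)) = inj₂ (proj₁ (⊲⇒< y⊲x))
      <⇒⊲ : ∀ {x y} → x ~ y → x < y → x ⊲ y
      <⇒⊲ (inj₁ refl)       x<y = ⊥-elim (proj₂ x<y refl)
      <⇒⊲ (inj₂ (inj₁ x⊲y)) x<y = x⊲y
      <⇒⊲ (inj₂ (inj₂ y⊲x)) x<y = ⊥-elim (<⇒≱ x<y (proj₁ (⊲⇒< y⊲x)))
      ⊲-Chain : Sub → Set
      ⊲-Chain E = (∀ {x} → E ∋ x → Q x) × (∀ {x y} → E ∋ x → E ∋ y → x ~ y)
      closed : ∀ s → (∀ n → ⊲-Chain (s n)) → Increasing s → ⊲-Chain ⟦ ⋃ s ⟧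
      closed s chains inc = (λ {x} Ex → in-Q (∋⁻ {⋃ s} {x} Ex)) , λ {x} {y} Ex Ey → related (∋⁻ {⋃ s} {x} Ex) (∋⁻ {⋃ s} {y} Ey)
        where
        in-Q : ∀ {x} → ⋃ s x → Q x
        in-Q (n , sx) = proj₁ (chains n) sx
        related : ∀ {x y} → ⋃ s x → ⋃ s y → x ~ y
        related sx sy with common-stage inc sx sy
        ... | n , snx , sny = proj₂ (chains n) snx sny
      Pair : Subset A
      Pair x = x ≡ p ⊎ x ≡ q
      pair-chain : ⊲-Chain ⟦ Pair ⟧
      pair-chain = (λ {x} Ex → in-Q (∋⁻ {Pair} {x} Ex)) , λ {x} {y} Ex Ey → related (∋⁻ {Pair} {x} Ex) (∋⁻ {Pair} {y} Ey)
        where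
        in-Q : ∀ {x} → Pair x → Q x
        in-Q (inj₁ refl) = proj₁ p⊲q
        in-Q (inj₂ refl) = proj₁ (proj₂ p⊲q)
        related : ∀ {x y} → Pair x → Pair y → x ~ y
        related (inj₁ refl) (inj₁ refl) = inj₁ refl
        related (inj₁ refl) (inj₂ refl) = inj₂ (inj₁ p⊲q)
        related (inj₂ refl) (inj₁ refl) = inj₂ (inj₂ p⊲q)
        related (inj₂ refl) (inj₂ refl) = inj₁ refl
      maximal-chain : Σ[ D ∈ Sub ] ⊲-Chain D × (∀ {x} → ⟦ Pair ⟧ ∋ x → D ∋ x) × Maximal ⊲-Chain D
      maximal-chain = zorn ⊲-Chain closed pair-chain
      D : Sub
      D = proj₁ maximal-chain
      D⊆Q : ∀ {x} → D ∋ x → Q x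
      D⊆Q = proj₁ (proj₁ (proj₂ maximal-chain))
      D-chain : ∀ {x y} → D ∋ x → D ∋ y → x ~ y
      D-chain = proj₂ (proj₁ (proj₂ maximal-chain))
      D-pair : ∀ {x} → Pair x → D ∋ x
      D-pair Px = proj₁ (proj₂ (proj₂ maximal-chain)) (∋⁺ {Pair} Px)
      D-dense : ∀ {x y} → D ∋ x → D ∋ y → x < y → Σ[ z ∈ A ] D ∋ z × x < z × z < y
      D-dense {x} {y} Dx Dy x<y with em (Σ[ z ∈ A ] D ∋ z × x < z × z < y)
      ... | yes between = between
      ... | no none with dense (<⇒⊲ (D-chain Dx Dy) x<y)
      ...   | z , x⊲z , z⊲y = z ,
        proj₂ (proj₂ (proj₂ maximal-chain))
          ((λ {w} Ew → in-Q (∋⁻ {D∪z} {w} Ew)) ,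
           λ {v} {w} Ev Ew → related (∋⁻ {D∪z} {v} Ev) (∋⁻ {D∪z} {w} Ew))
          (λ Dw → ∋⁺ {D∪z} (inj₁ Dw)) (∋⁺ {D∪z} (inj₂ refl)) ,
        ⊲⇒< x⊲z , ⊲⇒< z⊲y
        where
        D∪z : Subset A
        D∪z w = D ∋ w ⊎ w ≡ z
        in-Q : ∀ {w} → D∪z w → Q w
        in-Q (inj₁ Dw)   = D⊆Q Dw
        in-Q (inj₂ refl) = proj₁ z⊲y
        z~ : ∀ {w} → D ∋ w → w ⊲ z ⊎ z ⊲ w
        z~ {w} Dw with ⊲-chain⇒chain (D-chain Dw Dx) | ⊲-chain⇒chain (D-chain Dw Dy)
        ... | inj₁ w≤x | _        = inj₁ (≤-⊲-trans (D⊆Q Dw) w≤x x⊲z)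
        ... | inj₂ x≤w | inj₂ y≤w = inj₂ (⊲-≤-trans (D⊆Q Dw) z⊲y y≤w)
        ... | inj₂ x≤w | inj₁ w≤y with em (x ≡ w) | em (w ≡ y)
        ...   | yes refl | _        = inj₁ x⊲z
        ...   | no _     | yes refl = inj₂ z⊲y
        ...   | no x≢w   | no w≢y   = ⊥-elim (none (w , Dw , (x≤w , x≢w) , w≤y , w≢y))
        related : ∀ {v w} → D∪z v → D∪z w → v ~ w
        related (inj₁ Dv)   (inj₁ Dw)   = D-chain Dv Dw
        related (inj₁ Dv)   (inj₂ refl) = inj₂ (z~ Dv)
        related (inj₂ refl) (inj₁ Dw)   = inj₂ (swap (z~ Dw))
        related (inj₂ refl) (inj₂ refl) = inj₁ refl

    -- If neither `Q` nor its part above a midpoint `z` will do, a midpoint `w` of that part gives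
    -- `z ⊲ w`. Since `Q` is scattered, `⊲` is not dense, and an interval that witnesses this has no
    -- midpoint.
    noMid-exists : Convex Q → Sourced Q → Scattered Q →
      Σ[ Q′ ∈ Subset A ] Q′ ⊆ Q × Convex Q′ × Sourced Q′ × NoMid Q′
    noMid-exists convex sourced scattered with em (NoMid Q)
    ... | yes noMid = Q , id , convex , sourced , noMid
    ... | no mid with byContradiction mid
    ...   | z , Qz , _ , upper with em (NoMid (Q ↑ z))
    ...     | yes noMid = (Q ↑ z) , proj₁ ,
      (λ (Qx , z≤x) (Qy , _) x≤w w≤y → convex Qx Qy x≤w w≤y , ≤-trans z≤x x≤w) , upper , noMid
    ...     | no mid′ with byContradiction mid′
    ...       | w , (Qw , z≤w) , lower , _
      with em (Σ[ x ∈ A ] Σ[ y ∈ A ] x ⊲ y × ¬ (Σ[ t ∈ A ] x ⊲ t × t ⊲ y))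
    ...         | no dense = ⊥-elim (scattered (⊲-dense⇒HasDense
      (λ {x} {y} x⊲y → byContradiction λ none → dense (x , y , x⊲y , none)) (Qz , Qw , z≤w , lower)))
    ...         | yes (x , y , (Qx , Qy , x≤y , sourced′) , none) = ((Q ↑ x) ↓ y) , (λ q → proj₁ (proj₁ q)) ,
      (λ ((Qv , x≤v) , _) ((Qw , _) , w≤y) v≤t t≤w → (convex Qv Qw v≤t t≤w , ≤-trans x≤v v≤t) , ≤-trans t≤w w≤y) , sourced′ ,
      λ (t , ((Qt , x≤t) , t≤y) , lower′ , upper′) → none (t ,
        (Qx , Qt , x≤t , sourced-mono (((Q ↑ x) ↓ y) ↓ t) ((Q ↑ x) ↓ t) (λ ((q , _) , p) → q , p) lower′) ,
        (Qt , Qy , t≤y , sourced-mono (((Q ↑ x) ↓ y) ↑ t) ((Q ↑ t) ↓ y) (λ (((q , _) , p) , p′) → (q , p′) , p) upper′))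

  open Separation using (noMid-exists)

  unop-safe : ∀ {Q} → Σ[ B ∈ Subset A ] Σ A B × Op.SafeIn Q B → SafeChain Q
  unop-safe (B , b , B⊆Q , chain , safe) = B , b , B⊆Q , (λ x y Bx By → chain y x By Bx) , safe

  -- The finiteness in `GloballySafe` is not relative to `Q′`, so it survives the passage to the
  -- larger set.
  globallySafe⇒safe : ∀ {Q Q′} → Q′ ⊆ Q → Σ[ B ∈ Subset A ] Σ A B × GloballySafe Q′ B → SafeChain Q
  globallySafe⇒safe Q′⊆Q (B , b , B⊆Q′ , chain , safe) =
    B , b , (λ Bb → Q′⊆Q (B⊆Q′ Bb)) , chain , λ Bb → finite-⊆ (λ _ → proj₂) (safe Bb)

  safe-scattered : ∀ Q → Convex Q → Σ A Q → Scattered Q → SafeChain Q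
  safe-scattered Q convex (q , Qq) scattered with em (Finite Q)
  ... | yes fin = (_≡ q) , (q , refl) , (λ { refl → Qq }) , (λ { _ _ refl refl → inj₁ ≤-refl }) ,
    λ _ → finite-⊆ (λ _ → proj₁) fin
  ... | no inf with em (Finite (Initial Q)) | em (Finite (Op.Initial Q))
  ...   | no infInitial | _ = safe-initial infInitial
  ...   | yes _ | no infFinal =
    unop-safe (Op.safe-initial infFinal)
  ...   | yes finInitial | yes finFinal =
    -- An element neither initial nor final is a source, by `descend` and its dual.
    case infinite-∖ inf (finite-∪ finInitial finFinal) of λ (z , Qz , neither) →
    case noMid-exists Q convex (z , Qz , descend finInitial Qz (λ i → neither (inj₁ i)) ,
      Op.descend finFinal Qz (λ f → neither (inj₂ f))) scattered of λ (Q₁ , Q₁⊆Q , convex₁ , sourced₁ , noMid₁) →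
    case exhaust-steps Q₁ convex₁ sourced₁ noMid₁ of λ (Q₂ , Q₂⊆Q₁ , convex₂ , sourced₂ , lf) →
    globallySafe⇒safe (λ q → Q₁⊆Q (Q₂⊆Q₁ q)) (safe-sourced Q₂ convex₂ lf sourced₂)

  -- Sets containing a dense chain

  -- The centre `c` may belong to `D`, as for dense chains, or lie outside it, as for the maximal
  -- safe chain.
  Gap : Sub → A → Subset A
  Gap D c x = (∀ d → D ∋ d → d < c → d < x) × (∀ d → D ∋ d → c < d → x < d)

  gap-convex : ∀ D c → Convex (Gap D c)
  gap-convex D c (lower , _) (_ , upper) x≤y y≤z =
    (λ d Dd d<c → <-≤-trans (lower d Dd d<c) x≤y) , λ d Dd c<d → ≤-<-trans y≤z (upper d Dd c<d)

  gap-self : ∀ D c → Gap D c c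
  gap-self D c = (λ _ _ → id) , λ _ _ → id

  -- Having no endpoints, such a chain bounds the gap around each of its points on both sides, so
  -- the gap stays inside a convex `X`.
  OpenDense : Subset A → Sub → Set
  OpenDense X D = DenseChain X D × (∀ {x} → D ∋ x → Σ[ y ∈ A ] D ∋ y × y < x) × (∀ {x} → D ∋ x → Σ[ y ∈ A ] D ∋ y × x < y)

  OpenInterval : Sub → A → A → Subset A
  OpenInterval D x y z = D ∋ z × x < z × z < y

  openInterval-dense : ∀ X D {x y} → DenseChain X D → D ∋ x → D ∋ y → OpenDense X ⟦ OpenInterval D x y ⟧
  openInterval-dense X D {x} {y} (D⊆X , chain , dense) Dx Dy =
    ((λ {z} Iz → D⊆X (proj₁ (out z Iz))) ,
     (λ v w Iv Iw → chain v w (proj₁ (out v Iv)) (proj₁ (out w Iw))) ,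
     λ {v} {w} Iv Iw v<w → between v w (out v Iv) (out w Iw) v<w) ,
    (λ {z} Iz → below z (out z Iz)) , λ {z} Iz → above z (out z Iz)
    where
    I = OpenInterval D x y
    out : ∀ z → ⟦ I ⟧ ∋ z → I z
    out z = ∋⁻ {I} {z}
    between : ∀ v w → I v → I w → v < w → Σ[ z ∈ A ] ⟦ I ⟧ ∋ z × v < z × z < w
    between v w (Dv , x<v , _) (Dw , _ , w<y) v<w with dense Dv Dw v<w
    ... | z , Dz , v<z , z<w = z , ∋⁺ {I} (Dz , <-trans x<v v<z , <-trans z<w w<y) , v<z , z<w
    below : ∀ z → I z → Σ[ w ∈ A ] ⟦ I ⟧ ∋ w × w < z
    below z (Dz , x<z , z<y) with dense Dx Dz x<z
    ... | w , Dw , x<w , w<z = w , ∋⁺ {I} (Dw , x<w , <-trans w<z z<y) , w<z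
    above : ∀ z → I z → Σ[ w ∈ A ] ⟦ I ⟧ ∋ w × z < w
    above z (Dz , x<z , z<y) with dense Dz Dy z<y
    ... | w , Dw , z<w , w<y = w , ∋⁺ {I} (Dw , <-trans x<z z<w , w<y) , z<w

  openDense-closed : ∀ X s → (∀ n → OpenDense X (s n)) → Increasing s → OpenDense X ⟦ ⋃ s ⟧
  openDense-closed X s od inc =
    ((λ {x} Ux → in-X (out x Ux)) , (λ x y Ux Uy → chain (out x Ux) (out y Uy)) ,
     λ {x} {y} Ux Uy x<y → between (out x Ux) (out y Uy) x<y) ,
    (λ {x} Ux → below (out x Ux)) , λ {x} Ux → above (out x Ux)
    where
    out : ∀ x → ⟦ ⋃ s ⟧ ∋ x → ⋃ s x
    out x = ∋⁻ {⋃ s} {x}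
    in-X : ∀ {x} → ⋃ s x → X x
    in-X (n , sx) = proj₁ (proj₁ (od n)) sx
    chain : ∀ {x y} → ⋃ s x → ⋃ s y → x ≤ y ⊎ y ≤ x
    chain sx sy with common-stage inc sx sy
    ... | n , snx , sny = proj₁ (proj₂ (proj₁ (od n))) _ _ snx sny
    between : ∀ {x y} → ⋃ s x → ⋃ s y → x < y → Σ[ z ∈ A ] ⟦ ⋃ s ⟧ ∋ z × x < z × z < y
    between sx sy x<y with common-stage inc sx sy
    ... | n , snx , sny with proj₂ (proj₂ (proj₁ (od n))) snx sny x<y
    ...   | z , sz , lt = z , ∋⁺ {⋃ s} (n , sz) , lt
    below : ∀ {x} → ⋃ s x → Σ[ y ∈ A ] ⟦ ⋃ s ⟧ ∋ y × y < x
    below (n , sx) with proj₁ (proj₂ (od n)) sx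
    ... | y , sy , lt = y , ∋⁺ {⋃ s} (n , sy) , lt
    above : ∀ {x} → ⋃ s x → Σ[ y ∈ A ] ⟦ ⋃ s ⟧ ∋ y × x < y
    above (n , sx) with proj₂ (proj₂ (od n)) sx
    ... | y , sy , lt = y , ∋⁺ {⋃ s} (n , sy) , lt

  -- The gaps of a maximal dense chain are scattered: a dense chain inside one either
  -- enlarges the given chain or contains a dense chain beside the centre of the gap.
  module MaximalDense (X : Subset A) (B₀ : Sub) (B₀-dense : OpenDense X B₀) (maximal : Maximal (OpenDense X) B₀)
    (X-convex : Convex X) (beside-scattered : ∀ f → X f → ¬ HasDense (λ x → X x × x ∥ f))
    {b : A} (B₀b : B₀ ∋ b) where

    B₀-chain : Chain (B₀ ∋_)
    B₀-chain = proj₁ (proj₂ (proj₁ B₀-dense))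

    between : ∀ {x y} → B₀ ∋ x → B₀ ∋ y → x < y → Σ[ z ∈ A ] B₀ ∋ z × x < z × z < y
    between = proj₂ (proj₂ (proj₁ B₀-dense))

    gap⊆X : Gap B₀ b ⊆ X
    gap⊆X (lower , upper) with proj₁ (proj₂ B₀-dense) B₀b | proj₂ (proj₂ B₀-dense) B₀b
    ... | l , B₀l , l<b | u , B₀u , b<u =
      X-convex (proj₁ (proj₁ B₀-dense) B₀l) (proj₁ (proj₁ B₀-dense) B₀u) (proj₁ (lower l B₀l l<b)) (proj₁ (upper u B₀u b<u))

    -- Between `k` and `b` lies a further point of `K`. This keeps `B₀` together with `K` dense next
    -- to `b`; at other points of `B₀` the separating points come from `B₀`.
    Towards : Sub → A → Set
    Towards K k = (k < b × Σ[ z ∈ A ] K ∋ z × k < z × z < b) ⊎ (b < k × Σ[ z ∈ A ] K ∋ z × b < z × z < k)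

    module _ (K : Sub) (K-dense : OpenDense (Gap B₀ b) K) (towards : ∀ {k} → K ∋ k → Towards K k) where

      K⊆gap : ∀ {k} → K ∋ k → Gap B₀ b k
      K⊆gap = proj₁ (proj₁ K-dense)

      B₀∪K : Subset A
      B₀∪K w = B₀ ∋ w ⊎ K ∋ w

      Separated : A → A → Set
      Separated x y = x < y × Σ[ z ∈ A ] B₀∪K z × x < z × z < y

      separate : ∀ {c k} → B₀ ∋ c → K ∋ k → Separated c k ⊎ Separated k c
      separate {c} {k} B₀c Kk with em (c ≡ b) | B₀-chain c b B₀c B₀b
      ... | no c≢b | inj₁ c≤b with between B₀c B₀b (c≤b , c≢b)
      ...   | z , B₀z , c<z , z<b = inj₁ (lower c B₀c (c≤b , c≢b) , z , inj₁ B₀z , c<z , lower z B₀z z<b)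
        where lower = proj₁ (K⊆gap Kk)
      separate {c} {k} B₀c Kk | no c≢b | inj₂ b≤c with between B₀b B₀c (b≤c , λ e → c≢b (sym e))
      ...   | z , B₀z , b<z , z<c = inj₂ (upper c B₀c (b≤c , λ e → c≢b (sym e)) , z , inj₁ B₀z , upper z B₀z b<z , z<c)
        where upper = proj₂ (K⊆gap Kk)
      separate {c} {k} B₀c Kk | yes refl | _ with towards Kk
      ... | inj₁ (k<b , z , Kz , k<z , z<b) = inj₂ (k<b , z , inj₂ Kz , k<z , z<b)
      ... | inj₂ (b<k , z , Kz , b<z , z<k) = inj₁ (b<k , z , inj₂ Kz , b<z , z<k)

      merged : OpenDense X ⟦ B₀∪K ⟧
      merged = ((λ {x} Ux → in-X (out x Ux)) , (λ x y Ux Uy → chain (out x Ux) (out y Uy)) ,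
        λ {x} {y} Ux Uy x<y → dense (out x Ux) (out y Uy) x<y) , (λ {x} Ux → below (out x Ux)) , λ {x} Ux → above (out x Ux)
        where
        out : ∀ x → ⟦ B₀∪K ⟧ ∋ x → B₀∪K x
        out x = ∋⁻ {B₀∪K} {x}
        into : ∀ {P : Subset A} → Σ[ z ∈ A ] B₀∪K z × P z → Σ[ z ∈ A ] ⟦ B₀∪K ⟧ ∋ z × P z
        into (z , Uz , Pz) = z , ∋⁺ {B₀∪K} Uz , Pz
        in-X : ∀ {x} → B₀∪K x → X x
        in-X (inj₁ B₀x) = proj₁ (proj₁ B₀-dense) B₀x
        in-X (inj₂ Kx)  = gap⊆X (K⊆gap Kx)
        chain : ∀ {x y} → B₀∪K x → B₀∪K y → x ≤ y ⊎ y ≤ x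
        chain (inj₁ B₀x) (inj₁ B₀y) = B₀-chain _ _ B₀x B₀y
        chain (inj₂ Kx)  (inj₂ Ky)  = proj₁ (proj₂ (proj₁ K-dense)) _ _ Kx Ky
        chain (inj₁ B₀x) (inj₂ Ky) with separate B₀x Ky
        ... | inj₁ (x<y , _) = inj₁ (proj₁ x<y)
        ... | inj₂ (y<x , _) = inj₂ (proj₁ y<x)
        chain (inj₂ Kx) (inj₁ B₀y) = swap (chain (inj₁ B₀y) (inj₂ Kx))
        dense : ∀ {x y} → B₀∪K x → B₀∪K y → x < y → Σ[ z ∈ A ] ⟦ B₀∪K ⟧ ∋ z × x < z × z < y
        dense (inj₁ B₀x) (inj₁ B₀y) x<y with between B₀x B₀y x<y
        ... | z , B₀z , lt = into (z , inj₁ B₀z , lt)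
        dense (inj₂ Kx) (inj₂ Ky) x<y with proj₂ (proj₂ (proj₁ K-dense)) Kx Ky x<y
        ... | z , Kz , lt = into (z , inj₂ Kz , lt)
        dense (inj₁ B₀x) (inj₂ Ky) x<y with separate B₀x Ky
        ... | inj₁ (_ , z , Uz , lt) = into (z , Uz , lt)
        ... | inj₂ (y<x , _) = ⊥-elim (<⇒≱ x<y (proj₁ y<x))
        dense (inj₂ Kx) (inj₁ B₀y) x<y with separate B₀y Kx
        ... | inj₂ (_ , z , Uz , lt) = into (z , Uz , lt)
        ... | inj₁ (y<x , _) = ⊥-elim (<⇒≱ x<y (proj₁ y<x))
        below : ∀ {x} → B₀∪K x → Σ[ y ∈ A ] ⟦ B₀∪K ⟧ ∋ y × y < x
        below (inj₁ B₀x) with proj₁ (proj₂ B₀-dense) B₀x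
        ... | y , B₀y , lt = into (y , inj₁ B₀y , lt)
        below (inj₂ Kx) with proj₁ (proj₂ K-dense) Kx
        ... | y , Ky , lt = into (y , inj₂ Ky , lt)
        above : ∀ {x} → B₀∪K x → Σ[ y ∈ A ] ⟦ B₀∪K ⟧ ∋ y × x < y
        above (inj₁ B₀x) with proj₂ (proj₂ B₀-dense) B₀x
        ... | y , B₀y , lt = into (y , inj₁ B₀y , lt)
        above (inj₂ Kx) with proj₂ (proj₂ K-dense) Kx
        ... | y , Ky , lt = into (y , inj₂ Ky , lt)

      -- Maximality puts `k` into `B₀`; being in the gap and on one side of `b`, it would lie
      -- strictly beyond itself.
      no-dense-towards : ∀ {k} → ¬ K ∋ k
      no-dense-towards {k} Kk = outside-itself (towards Kk)
        where
        B₀k : B₀ ∋ k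
        B₀k = maximal merged (λ B₀w → ∋⁺ {B₀∪K} (inj₁ B₀w)) (∋⁺ {B₀∪K} (inj₂ Kk))
        outside-itself : ¬ Towards K k
        outside-itself (inj₁ (k<b , _)) = proj₂ (proj₁ (K⊆gap Kk) k B₀k k<b) refl
        outside-itself (inj₂ (b<k , _)) = proj₂ (proj₂ (K⊆gap Kk) k B₀k b<k) refl

    gap-scattered : Scattered (Gap B₀ b)
    gap-scattered (D , D-dense@(D⊆gap , D-chain , D-between) , x , y , Dx , Dy , x<y) = refute
      where
      side : ∀ {p q} → D ∋ p → D ∋ q → p < q → q ≤ b ⊎ b ≤ p ⊎ (p ∥ b × q ∥ b) → ⊥
      side {p} {q} Dp Dq p<q place = go place
        where
        I = OpenInterval D p q
        K = ⟦ I ⟧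
        K-dense : OpenDense (Gap B₀ b) K
        K-dense = openInterval-dense (Gap B₀ b) D D-dense Dp Dq
        out : ∀ {z} → K ∋ z → I z
        out {z} = ∋⁻ {I} {z}
        middle : Σ[ z ∈ A ] K ∋ z
        middle with D-between Dp Dq p<q
        ... | z , Dz , p<z , z<q = z , ∋⁺ {I} (Dz , p<z , z<q)
        go : q ≤ b ⊎ b ≤ p ⊎ (p ∥ b × q ∥ b) → ⊥
        go (inj₁ q≤b) = no-dense-towards K K-dense towards (proj₂ middle)
          where
          towards : ∀ {k} → K ∋ k → Towards K k
          towards Kk with proj₂ (proj₂ K-dense) Kk
          ... | z , Kz , k<z = inj₁ (<-≤-trans (proj₂ (proj₂ (out Kk))) q≤b , z , Kz , k<z , <-≤-trans (proj₂ (proj₂ (out Kz))) q≤b)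
        go (inj₂ (inj₁ b≤p)) = no-dense-towards K K-dense towards (proj₂ middle)
          where
          towards : ∀ {k} → K ∋ k → Towards K k
          towards Kk with proj₁ (proj₂ K-dense) Kk
          ... | z , Kz , z<k = inj₂ (≤-<-trans b≤p (proj₁ (proj₂ (out Kk))) , z , Kz , ≤-<-trans b≤p (proj₁ (proj₂ (out Kz))) , z<k)
        go (inj₂ (inj₂ (p∥b , q∥b))) = beside-scattered b (proj₁ (proj₁ B₀-dense) B₀b)
          (K , ((λ Kz → gap⊆X (proj₁ (proj₁ K-dense) Kz) ,
                   ∥-convex p∥b q∥b (proj₁ (proj₁ (proj₂ (out Kz)))) (proj₁ (proj₂ (proj₂ (out Kz))))) ,
                proj₁ (proj₂ (proj₁ K-dense)) , proj₂ (proj₂ (proj₁ K-dense))) ,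
           proj₁ middle , proj₁ next , proj₂ middle , proj₁ (proj₂ next) , proj₂ (proj₂ next))
          where next = proj₂ (proj₂ K-dense) (proj₂ middle)
      refute : ⊥
      -- Going up in `D`, the position relative to `b` passes from below through incomparable to
      -- above, so at most two subdivisions give two points in the same position.
      refute with compare x b | D-between Dx Dy x<y
      ... | inj₂ (inj₁ b≤x) | _ = side Dx Dy x<y (inj₂ (inj₁ b≤x))
      ... | inj₁ x≤b | z , Dz , x<z , z<y with compare z b
      ...   | inj₁ z≤b        = side Dx Dz x<z (inj₁ z≤b)
      ...   | inj₂ (inj₁ b≤z) = side Dz Dy z<y (inj₂ (inj₁ b≤z))
      ...   | inj₂ (inj₂ z∥b) with D-between Dx Dz x<z
      ...     | w , Dw , x<w , w<z with compare w b
      ...       | inj₁ w≤b        = side Dx Dw x<w (inj₁ w≤b)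
      ...       | inj₂ (inj₁ b≤w) = ∥⇒≱ z∥b (≤-trans b≤w (proj₁ w<z))
      ...       | inj₂ (inj₂ w∥b) = side Dw Dz w<z (inj₂ (inj₂ (w∥b , z∥b)))
      refute | inj₂ (inj₂ x∥b) | z , Dz , x<z , z<y with compare z b
      ...   | inj₁ z≤b        = ∥⇒≰ x∥b (≤-trans (proj₁ x<z) z≤b)
      ...   | inj₂ (inj₁ b≤z) = side Dz Dy z<y (inj₂ (inj₁ b≤z))
      ...   | inj₂ (inj₂ z∥b) = side Dx Dz x<z (inj₂ (inj₂ (x∥b , z∥b)))

  -- An element beside a point of one piece lies in the gap of that piece: by density, infinitely
  -- many pieces lie between it and any `d` in `B₀`, and `beside-above-asc` or its dual places the
  -- element beyond one of them. Safety of the single piece then suffices.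
  glue : ∀ {Q} X B₀ → OpenDense X B₀ → (∀ {b} → B₀ ∋ b → Gap B₀ b ⊆ Q) →
    (∀ b → B₀ ∋ b → SafeChain (Gap B₀ b)) → Σ[ b ∈ A ] B₀ ∋ b → SafeChain Q
  glue {Q} X B₀ ((_ , B₀-chain , between) , _) gap⊆Q piece (b₀ , B₀b₀) =
    B , (member B₀b₀ , _ , B₀b₀ , member∈ B₀b₀) , (λ (b , p , Px) → gap⊆Q p (P⊆gap p Px)) , chain , safe
    where
    P : ∀ {b} → B₀ ∋ b → Subset A
    P {b} p = proj₁ (piece b p)
    member : ∀ {b} → B₀ ∋ b → A
    member {b} p = proj₁ (proj₁ (proj₂ (piece b p)))
    member∈ : ∀ {b} (p : B₀ ∋ b) → P p (member p)
    member∈ {b} p = proj₂ (proj₁ (proj₂ (piece b p)))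
    P⊆gap : ∀ {b} (p : B₀ ∋ b) {x} → P p x → Gap B₀ b x
    P⊆gap {b} p = proj₁ (proj₂ (proj₂ (piece b p)))
    P-chain : ∀ {b} (p : B₀ ∋ b) → Chain (P p)
    P-chain {b} p = proj₁ (proj₂ (proj₂ (proj₂ (piece b p))))
    P-safe : ∀ {b} (p : B₀ ∋ b) {y} → P p y → Finite (λ x → Gap B₀ b x × Beside (P p) y x)
    P-safe {b} p = proj₂ (proj₂ (proj₂ (proj₂ (piece b p))))
    P-< : ∀ {b b′} (p : B₀ ∋ b) (p′ : B₀ ∋ b′) {x y} → b < b′ → P p x → P p′ y → x < y
    P-< p p′ b<b′ Px Py with between p p′ b<b′
    ... | c , B₀c , b<c , c<b′ = <-trans (proj₂ (P⊆gap p Px) c B₀c b<c) (proj₁ (P⊆gap p′ Py) c B₀c c<b′)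
    B : Subset A
    B x = Σ[ b ∈ A ] Σ[ p ∈ B₀ ∋ b ] P p x
    chain : Chain B
    chain x y (b , p , Px) (b′ , p′ , Py) with em (b ≡ b′) | B₀-chain b b′ p p′
    -- Pieces depend on the membership proof, so two proofs for the same `b` have to be identified.
    ... | yes refl | _ = P-chain p x y Px (subst (λ q → P q y) (≡-irrelevant p′ p) Py)
    ... | no b≢b′ | inj₁ b≤b′ = inj₁ (proj₁ (P-< p p′ (b≤b′ , b≢b′) Px Py))
    ... | no b≢b′ | inj₂ b′≤b = inj₂ (proj₁ (P-< p′ p (b′≤b , λ e → b≢b′ (sym e)) Py Px))
    in-gap : ∀ {b} (p : B₀ ∋ b) {y x} → P p y → Beside B y x → Gap B₀ b x
    in-gap {b} p {y} {x} Py beside = lower , upper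
      where
      lower : ∀ d → B₀ ∋ d → d < b → d < x
      lower d B₀d d<b = case beside-above-asc asc (λ n → _ , elem n , member∈ (elem n))
        (λ n → proj₁ (P-< (elem n) p (proj₂ (proj₂ (proj₂ (s n)))) (member∈ (elem n)) Py)) beside of λ (n , e≤x) → <-≤-trans (proj₁ (P⊆gap (elem n) (member∈ (elem n))) d B₀d (proj₁ (proj₂ (proj₂ (s n))))) e≤x
        where
        State : Set
        State = Σ[ c ∈ A ] B₀ ∋ c × d < c × c < b
        next : (t : State) → Σ[ t′ ∈ State ] proj₁ t < proj₁ t′
        next (c , B₀c , d<c , c<b) with between B₀c p c<b
        ... | c′ , B₀c′ , c<c′ , c′<b = (c′ , B₀c′ , <-trans d<c c<c′ , c′<b) , c<c′
        chosen : Σ[ s ∈ (ℕ → State) ] Asc (proj₁ ∘ s)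
        chosen = dependentChoice {R = λ t t′ → proj₁ t < proj₁ t′} next (between B₀d p d<b)
        s : ℕ → State
        s = proj₁ chosen
        elem : ∀ n → B₀ ∋ proj₁ (s n)
        elem n = proj₁ (proj₂ (s n))
        asc : Asc (λ n → member (elem n))
        asc n = P-< (elem n) (elem (suc n)) (proj₂ chosen n) (member∈ (elem n)) (member∈ (elem (suc n)))
      upper : ∀ d → B₀ ∋ d → b < d → x < d
      upper d B₀d b<d = case Op.beside-above-asc desc (λ n → _ , elem n , member∈ (elem n))
        (λ n → proj₁ (P-< p (elem n) (proj₁ (proj₂ (proj₂ (s n)))) Py (member∈ (elem n)))) beside of λ (n , x≤e) → ≤-<-trans x≤e (proj₂ (P⊆gap (elem n) (member∈ (elem n))) d B₀d (proj₂ (proj₂ (proj₂ (s n)))))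
        where
        State : Set
        State = Σ[ c ∈ A ] B₀ ∋ c × b < c × c < d
        next : (t : State) → Σ[ t′ ∈ State ] proj₁ t′ < proj₁ t
        next (c , B₀c , b<c , c<d) with between p B₀c b<c
        ... | c′ , B₀c′ , b<c′ , c′<c = (c′ , B₀c′ , b<c′ , <-trans c′<c c<d) , c′<c
        chosen : Σ[ s ∈ (ℕ → State) ] ∀ n → proj₁ (s (suc n)) < proj₁ (s n)
        chosen = dependentChoice {R = λ t t′ → proj₁ t′ < proj₁ t} next (between p B₀d b<d)
        s : ℕ → State
        s = proj₁ chosen
        elem : ∀ n → B₀ ∋ proj₁ (s n)
        elem n = proj₁ (proj₂ (s n))
        desc : Desc (λ n → member (elem n))
        desc n = proj₁ down , λ e → proj₂ down (sym e)
          where down = P-< (elem (suc n)) (elem n) (proj₂ chosen n) (member∈ (elem (suc n))) (member∈ (elem n))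
    safe : ∀ {y} → B y → Finite (λ x → Q x × Beside B y x)
    safe (b , p , Py) = finite-⊆ (λ x (_ , beside) → in-gap p Py beside , proj₁ beside ,
      finite-⊆ (λ z (Pz , z∥x) → (b , p , Pz) , z∥x) (proj₂ beside)) (P-safe p Py)

  hasDense-mono : ∀ {Q Q′} → Q ⊆ Q′ → HasDense Q → HasDense Q′
  hasDense-mono Q⊆Q′ (D , (D⊆Q , rest) , pair) = D , ((λ Dx → Q⊆Q′ (D⊆Q Dx)) , rest) , pair

  Off : Subset A → List A → Subset A
  Off Q es x = Q x × (∀ e → e ∈ es → x ∥ e)

  -- Otherwise some `f` could always be added to `es` with a dense chain remaining, and these `f`
  -- would form an infinite antichain.
  off-scattered-beside : ∀ Q → HasDense Q →
    Σ[ es ∈ List A ] HasDense (Off Q es) × (∀ f → Off Q es f → ¬ HasDense (λ x → Off Q es x × x ∥ f))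
  off-scattered-beside Q dense = byContradiction λ none →
    no-infinite-antichain (λ es → HasDense (Off Q es)) (hasDense-mono (λ Qx → Qx , λ e ()) dense) (step none)
    where
    add : ∀ {es f x} → Off Q es x × x ∥ f → Off Q (f ∷ es) x
    add ((Qx , off) , x∥f) = Qx , λ where
      _ (here refl) → x∥f
      e (there i)   → off e i
    step : ¬ (Σ[ es ∈ List A ] HasDense (Off Q es) × (∀ f → Off Q es f → ¬ HasDense (λ x → Off Q es x × x ∥ f))) →
      ∀ es → HasDense (Off Q es) → Σ[ e ∈ A ] HasDense (Off Q (e ∷ es)) × (∀ e′ → e′ ∈ es → e′ ∥ e)
    step none es d = byContradiction λ stop → none (es , d , λ f (Qf , off) d′ →
      stop (f , hasDense-mono add d′ , λ e′ i → ∥-sym (off e′ i)))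

  safe-dense : ∀ Q → Convex Q → HasDense Q → SafeChain Q
  safe-dense Q convex dense =
    case off-scattered-beside Q dense of λ (es , (D , D-dense , x , y , Dx , Dy , x<y) , scattered) →
    start es D D-dense Dx Dy x<y scattered
    where
    start : ∀ es D {x y} → DenseChain (Off Q es) D → D ∋ x → D ∋ y → x < y →
      (∀ f → Off Q es f → ¬ HasDense (λ x → Off Q es x × x ∥ f)) → SafeChain Q
    start es D {x} {y} D-dense Dx Dy x<y scattered =
      finish (zorn (OpenDense X) (openDense-closed X) (openInterval-dense X D D-dense Dx Dy))
      where
      X = Off Q es
      X-convex : Convex X
      X-convex (Qx , offx) (Qz , offz) x≤y y≤z = convex Qx Qz x≤y y≤z , λ e i → ∥-convex (offx e i) (offz e i) x≤y y≤z
      finish : Σ[ B ∈ Sub ] OpenDense X B × (∀ {z} → ⟦ OpenInterval D x y ⟧ ∋ z → B ∋ z) × Maximal (OpenDense X) B → SafeChain Q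
      finish (B₀ , B₀-dense , I⊆B₀ , maximal) = glue X B₀ B₀-dense (λ B₀b g → proj₁ (M.gap⊆X B₀b g))
        (λ b B₀b → safe-scattered (Gap B₀ b) (gap-convex B₀ b) (b , gap-self B₀ b) (M.gap-scattered B₀b))
        (case proj₂ (proj₂ D-dense) Dx Dy x<y of λ (z , Dz , x<z , z<y) → z , I⊆B₀ (∋⁺ {OpenInterval D x y} (Dz , x<z , z<y)))
        where module M {b} (B₀b : B₀ ∋ b) = MaximalDense X B₀ B₀-dense maximal X-convex scattered B₀b

  safe-chain-exists : ∀ Q → Convex Q → Σ A Q → SafeChain Q
  safe-chain-exists Q convex inhabited with em (HasDense Q)
  ... | yes dense    = safe-dense Q convex dense
  ... | no scattered = safe-scattered Q convex inhabited scattered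

  -- A maximal safe chain

  Safe : Sub → Set
  Safe D = Chain (D ∋_) × (∀ {d} → D ∋ d → Finite (Beside (D ∋_) d))

  safe-closed : ∀ s → (∀ n → Safe (s n)) → Increasing s → Safe ⟦ ⋃ s ⟧
  safe-closed s safes inc = (λ x y Ux Uy → chain (∋⁻ {⋃ s} {x} Ux) (∋⁻ {⋃ s} {y} Uy)) , λ {d} Ud → safe (∋⁻ {⋃ s} {d} Ud)
    where
    chain : ∀ {x y} → ⋃ s x → ⋃ s y → x ≤ y ⊎ y ≤ x
    chain sx sy with common-stage inc sx sy
    ... | n , snx , sny = proj₁ (safes n) _ _ snx sny
    safe : ∀ {d} → ⋃ s d → Finite (Beside (⟦ ⋃ s ⟧ ∋_) d)
    safe (n , sd) = finite-⊆ (λ x (x∥d , fin) → x∥d , finite-⊆ (λ e (se , e∥x) → ∋⁺ {⋃ s} (n , se) , e∥x) fin) (proj₂ (safes n) sd)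

  -- Counts the elements beside `b` that lie outside the gap of `x` in `D`. Here `b` has at least
  -- the position of `x` relative to `D`.
  neighbours-finite : ∀ {D} → Safe D → ∀ x b →
    (∀ {d} → D ∋ d → d ≤ x → d < b) → (∀ {d} → D ∋ d → x ≤ d → b < d) →
    Finite (λ y → Beside (D ∋_) b y × ((Σ[ d ∈ A ] D ∋ d × d ≤ x × ¬ d < y) ⊎ (Σ[ d ∈ A ] D ∋ d × x ≤ d × ¬ y < d)))
  neighbours-finite {D} (chain , safe) x b d<b b<d = finite-⊆
    (λ where
      y (beside , inj₁ low)                    → inj₁ (beside , low)
      y (beside , inj₂ (d , Dd , x≤d , y≮d)) → inj₂ (beside , d , Dd , x≤d , λ (y≤d , d≢y) → y≮d (y≤d , λ e → d≢y (sym e))))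
    (finite-∪ (lower-neighbours-finite chain safe x b d<b)
      (Op.lower-neighbours-finite (λ v w Dv Dw → chain w v Dw Dv) safe x b
        (λ Dd x≤d → proj₁ (b<d Dd x≤d) , λ e → proj₂ (b<d Dd x≤d) (sym e))))

  -- If `x` were comparable to all of `D`, a safe chain in its gap could be adjoined. Elements
  -- beside a new point are finitely many inside the gap by safety of the new chain, and outside it
  -- by `neighbours-finite`.
  maximal-safe-decides : ∀ {D} → Safe D → Maximal Safe D → ∀ {x} → ¬ D ∋ x → Σ[ d ∈ A ] D ∋ d × d ∥ x
  maximal-safe-decides {D} (chain , safe) maximal {x} x∉D = byContradiction λ none →
    extend none (safe-chain-exists (Gap D x) (gap-convex D x) (x , gap-self D x))
    where
    extend : ¬ (Σ[ d ∈ A ] D ∋ d × d ∥ x) → SafeChain (Gap D x) → ⊥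
    extend none (B , (b , Bb) , B⊆gap , B-chain , B-safe) =
      outside (maximal (E-chain , λ {d} Ed → E-safe (∋⁻ {E} {d} Ed)) (λ Dw → ∋⁺ {E} (inj₁ Dw)) (∋⁺ {E} (inj₂ Bb)))
      where
      E : Subset A
      E w = D ∋ w ⊎ B w
      strict : ∀ {d} → D ∋ d → d < x ⊎ x < d
      strict {d} Dd with compare d x
      ... | inj₁ d≤x        = inj₁ (d≤x , λ { refl → x∉D Dd })
      ... | inj₂ (inj₁ x≤d) = inj₂ (x≤d , λ { refl → x∉D Dd })
      ... | inj₂ (inj₂ d∥x) = ⊥-elim (none (d , Dd , d∥x))
      outside : ¬ D ∋ b
      outside Db with strict Db
      ... | inj₁ b<x = proj₂ (proj₁ (B⊆gap Bb) b Db b<x) refl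
      ... | inj₂ x<b = proj₂ (proj₂ (B⊆gap Bb) b Db x<b) refl
      below : ∀ {y d} → Gap D x y → D ∋ d → d ≤ x → d < y
      below (lower , _) Dd d≤x = lower _ Dd (d≤x , λ { refl → x∉D Dd })
      above : ∀ {y d} → Gap D x y → D ∋ d → x ≤ d → y < d
      above (_ , upper) Dd x≤d = upper _ Dd (x≤d , λ { refl → x∉D Dd })
      cross : ∀ {d y} → D ∋ d → B y → d ≤ y ⊎ y ≤ d
      cross Dd By with strict Dd
      ... | inj₁ d<x = inj₁ (proj₁ (proj₁ (B⊆gap By) _ Dd d<x))
      ... | inj₂ x<d = inj₂ (proj₁ (proj₂ (B⊆gap By) _ Dd x<d))
      E-chain : Chain (⟦ E ⟧ ∋_)
      E-chain v w Ev Ew with ∋⁻ {E} {v} Ev | ∋⁻ {E} {w} Ew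
      ... | inj₁ Dv | inj₁ Dw = chain v w Dv Dw
      ... | inj₁ Dv | inj₂ Bw = cross Dv Bw
      ... | inj₂ Bv | inj₁ Dw = swap (cross Dw Bv)
      ... | inj₂ Bv | inj₂ Bw = B-chain v w Bv Bw
      classify : ∀ {β} y → Beside (⟦ E ⟧ ∋_) β y →
        (Gap D x y × Beside B β y) ⊎
        (Beside (D ∋_) β y × ((Σ[ d ∈ A ] D ∋ d × d ≤ x × ¬ d < y) ⊎ (Σ[ d ∈ A ] D ∋ d × x ≤ d × ¬ y < d)))
      classify y (y∥β , fin) with em (Σ[ d ∈ A ] D ∋ d × d ≤ x × ¬ d < y) | em (Σ[ d ∈ A ] D ∋ d × x ≤ d × ¬ y < d)
      ... | yes low | _        = inj₂ ((y∥β , finite-⊆ (λ e (De , e∥y) → ∋⁺ {E} (inj₁ De) , e∥y) fin) , inj₁ low)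
      ... | no _    | yes high = inj₂ ((y∥β , finite-⊆ (λ e (De , e∥y) → ∋⁺ {E} (inj₁ De) , e∥y) fin) , inj₂ high)
      ... | no noLow | no noHigh = inj₁
        (((λ d Dd d<x → byContradiction λ d≮y → noLow (d , Dd , proj₁ d<x , d≮y)) ,
          (λ d Dd x<d → byContradiction λ y≮d → noHigh (d , Dd , proj₁ x<d , y≮d))) ,
         y∥β , finite-⊆ (λ e (Be , e∥y) → ∋⁺ {E} (inj₂ Be) , e∥y) fin)
      E-safe : ∀ {d} → E d → Finite (Beside (⟦ E ⟧ ∋_) d)
      E-safe (inj₁ Dd) = finite-⊆ (λ y (y∥d , fin) → y∥d , finite-⊆ (λ e (De , e∥y) → ∋⁺ {E} (inj₁ De) , e∥y) fin) (safe Dd)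
      E-safe (inj₂ Bβ) = finite-⊆ classify (finite-∪ (B-safe Bβ)
        (neighbours-finite (chain , safe) x _ (below (B⊆gap Bβ)) (above (B⊆gap Bβ))))

  -- Spines of thin sets

  -- The antichains are the fibres of `f` and the chain is its image; idempotence makes each fibre
  -- meet the image.
  record SpineOn (R : Subset A) (f : A → A) : Set where
    field
      closed     : ∀ {x} → R x → R (f x)
      idempotent : ∀ {x} → R x → f (f x) ≡ f x
      comparable : ∀ {x y} → R x → R y → f x ≤ f y ⊎ f y ≤ f x
      antichain  : ∀ {x y} → R x → R y → f x ≡ f y → x ≤ y → x ≡ y

  choose : {X : Set} → Dec X → A → A → A
  choose (yes _) a _ = a
  choose (no _)  _ b = b

  choose-yes : ∀ {X : Set} (d : Dec X) {a b} → X → choose d a b ≡ a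
  choose-yes (yes _) _ = refl
  choose-yes (no ¬x) x = ⊥-elim (¬x x)

  choose-no : ∀ {X : Set} (d : Dec X) {a b} → ¬ X → choose d a b ≡ b
  choose-no (yes x) ¬x = ⊥-elim (¬x x)
  choose-no (no _)  _  = refl

  list-noDesc : ∀ xs → ¬ HasDesc (_∈ xs)
  list-noDesc xs (d , desc , d∈) = injective⇒infinite (Reversed.asc-injective desc) d∈ (xs , λ _ i → i)

  -- The minimal elements form one antichain; it is met below the chain of the remaining elements.
  finite-spine : ∀ n xs → length xs ≤ₙ n → Σ (A → A) (SpineOn (_∈ xs))
  finite-spine _ [] _ = id , record
    { closed = id ; idempotent = λ _ → refl ; comparable = λ () ; antichain = λ () }
  finite-spine (suc n) xs@(a ∷ _) len = extend (finite-spine n rest rest-shorter)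
    where
    Min : A → Set
    Min = Minimal (_∈ xs)
    NotMin? : ∀ x → Dec (¬ Min x)
    NotMin? x = em (¬ Min x)
    rest : List A
    rest = filter NotMin? xs
    lowest : ∀ {x} → x ∈ xs → Σ[ m ∈ A ] m ∈ xs × m ≤ x × Min m
    lowest = minimal-below {_∈ xs} (list-noDesc xs)
    rest-shorter : length rest ≤ₙ n
    rest-shorter with lowest (here refl)
    ... | m , m∈xs , _ , min = ℕ.≤-pred (ℕ.≤-trans (filter-notAll NotMin? xs (lose m∈xs (λ notMin → notMin min))) len)
    in-rest : ∀ {x} → x ∈ xs → ¬ Min x → x ∈ rest
    in-rest = ∈-filter⁺ NotMin?
    from-rest : ∀ {x} → x ∈ rest → x ∈ xs × ¬ Min x
    from-rest = ∈-filter⁻ NotMin? {xs = xs}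
    extend : Σ (A → A) (SpineOn (_∈ rest)) → Σ (A → A) (SpineOn (_∈ xs))
    extend (f′ , spine′) = attach root
      where
      open SpineOn spine′ renaming
        (closed to closed′; idempotent to idempotent′; comparable to comparable′; antichain to antichain′)
      Root : Set
      Root = Σ[ m ∈ A ] m ∈ xs × Min m × (∀ y → y ∈ rest → m ≤ f′ y)
      Image : Subset A
      Image z = Σ[ x ∈ A ] x ∈ rest × f′ x ≡ z
      image-noDesc : ¬ HasDesc Image
      image-noDesc (d , desc , d∈) = list-noDesc rest (d , desc , λ n → in-list (d∈ n))
        where
        in-list : ∀ {z} → Image z → z ∈ rest
        in-list (x , i , refl) = closed′ i
      root : Root
      root with em (Σ[ x ∈ A ] x ∈ rest)
      ... | no empty = case lowest (here refl) of λ (m , m∈ , _ , min) → m , m∈ , min , λ y i → ⊥-elim (empty (y , i))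
      ... | yes (x , x∈rest) with minimal-below {Image} image-noDesc (x , x∈rest , refl)
      ...   | _ , (y , y∈rest , refl) , _ , least-image with lowest (proj₁ (from-rest (closed′ y∈rest)))
      ...     | m , m∈ , m≤ , min = m , m∈ , min , below
        where
        below : ∀ z → z ∈ rest → m ≤ f′ z
        below z z∈rest with comparable′ y∈rest z∈rest
        ... | inj₁ y≤z = ≤-trans m≤ y≤z
        ... | inj₂ z≤y = subst (m ≤_) (sym (least-image (f′ z) (z , z∈rest , refl) z≤y)) m≤
      attach : Root → Σ (A → A) (SpineOn (_∈ xs))
      attach (m , m∈ , m-min , m≤) = f , record
        { closed = closed ; idempotent = idempotent ; comparable = comparable ; antichain = antichain }
        where
        f : A → A
        f x = choose (em (Min x)) m (f′ x)
        f-min : ∀ {x} → Min x → f x ≡ m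
        f-min {x} = choose-yes (em (Min x))
        f-rest : ∀ {x} → ¬ Min x → f x ≡ f′ x
        f-rest {x} = choose-no (em (Min x))
        data View (x : A) : Set where
          minimal : Min x → f x ≡ m → View x
          other   : ¬ Min x → x ∈ rest → f x ≡ f′ x → View x
        view : ∀ {x} → x ∈ xs → View x
        view {x} i with em (Min x)
        ... | yes min   = minimal min (f-min min)
        ... | no notMin = other notMin (in-rest i notMin) (f-rest notMin)
        closed : ∀ {x} → x ∈ xs → f x ∈ xs
        closed i with view i
        ... | minimal _ e   = subst (_∈ xs) (sym e) m∈
        ... | other _ i′ e = subst (_∈ xs) (sym e) (proj₁ (from-rest (closed′ i′)))
        idempotent : ∀ {x} → x ∈ xs → f (f x) ≡ f x
        idempotent i with view i
        ... | minimal _ e   = trans (cong f e) (trans (f-min m-min) (sym e))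
        ... | other _ i′ e = trans (cong f e) (trans (f-rest (proj₂ (from-rest (closed′ i′)))) (trans (idempotent′ i′) (sym e)))
        transport : ∀ {x y a b} → f x ≡ a → f y ≡ b → a ≤ b ⊎ b ≤ a → f x ≤ f y ⊎ f y ≤ f x
        transport ex ey = subst₂ (λ u v → u ≤ v ⊎ v ≤ u) (sym ex) (sym ey)
        comparable : ∀ {x y} → x ∈ xs → y ∈ xs → f x ≤ f y ⊎ f y ≤ f x
        comparable i j with view i | view j
        ... | minimal _ ex   | minimal _ ey   = transport ex ey (inj₁ ≤-refl)
        ... | minimal _ ex   | other _ j′ ey = transport ex ey (inj₁ (m≤ _ j′))
        ... | other _ i′ ex | minimal _ ey   = transport ex ey (inj₂ (m≤ _ i′))
        ... | other _ i′ ex | other _ j′ ey = transport ex ey (comparable′ i′ j′)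
        antichain : ∀ {x y} → x ∈ xs → y ∈ xs → f x ≡ f y → x ≤ y → x ≡ y
        antichain {x} i j e x≤y with view i | view j
        ... | minimal _ _      | minimal y-min _   = y-min x i x≤y
        ... | other _ i′ ex    | other _ j′ ey     = antichain′ i′ j′ (trans (sym ex) (trans e ey)) x≤y
        ... | minimal _ ex     | other _ j′ ey     =
          ⊥-elim (proj₂ (from-rest (closed′ j′)) (subst Min (trans (sym ex) (trans e ey)) m-min))
        ... | other _ i′ ex    | minimal _ ey      =
          ⊥-elim (proj₂ (from-rest (closed′ i′)) (subst Min (trans (sym ey) (trans (sym e) ex)) m-min))

  -- Compactness: from finite spines to a spine of a thin set

  module Compactness (R : Subset A) (thin : Thin R) where

    Coded : ℕ → Set
    Coded n = Σ[ x ∈ A ] code x ≡ n × R x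

    initial-segment : ℕ → List A
    initial-segment zero    = []
    initial-segment (suc n) with em (Coded n)
    ... | yes (x , _) = x ∷ initial-segment n
    ... | no _        = initial-segment n

    segment⊆R : ∀ n {x} → x ∈ initial-segment n → R x
    segment⊆R (suc n) i with em (Coded n) | i
    ... | yes (x , _ , Rx) | here refl = Rx
    ... | yes _            | there i′  = segment⊆R n i′
    ... | no _             | i′        = segment⊆R n i′

    R⊆segment : ∀ n {x} → R x → code x <ₙ n → x ∈ initial-segment n
    R⊆segment (suc n) {x} Rx c<1+n with em (Coded n) | ℕ.m≤n⇒m<n∨m≡n (ℕ.m<1+n⇒m≤n c<1+n)
    ... | yes _            | inj₁ c<n = there (R⊆segment n Rx c<n)
    ... | no _             | inj₁ c<n = R⊆segment n Rx c<n
    ... | yes (y , cy , _) | inj₂ cx  = here (code-injective (trans cx (sym cy)))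
    ... | no none          | inj₂ cx  = ⊥-elim (none (x , cx , Rx))

    approximation : ∀ n → Σ (A → A) (SpineOn (_∈ initial-segment n))
    approximation n = finite-spine (length (initial-segment n)) (initial-segment n) ℕ.≤-refl

    F : ℕ → A → A
    F n = proj₁ (approximation n)

    module F n = SpineOn (proj₂ (approximation n))

    Unbounded : Subset ℕ → Set
    Unbounded N = ∀ k → Σ[ n ∈ ℕ ] k ≤ₙ n × N n

    -- The value `F n x` lies in the same antichain as `x`, so it is `x` or incomparable to `x`;
    -- thinness leaves finitely many possibilities.
    values-finite : ∀ {x} → R x → Finite (λ v → Σ[ n ∈ ℕ ] code x <ₙ n × F n x ≡ v)
    values-finite {x} Rx = finite-⊆ near (finite-∪ {S = _≡ x} (x ∷ [] , λ { _ refl → here refl }) (thin Rx))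
      where
      near : ∀ v → Σ[ n ∈ ℕ ] code x <ₙ n × F n x ≡ v → v ≡ x ⊎ (R v × v ∥ x)
      near _ (n , c<n , refl) with compare (F n x) x
      ... | inj₁ v≤x        = inj₁ (F.antichain n (F.closed n i) i (F.idempotent n i) v≤x)
        where i = R⊆segment n Rx c<n
      ... | inj₂ (inj₁ x≤v) = inj₁ (sym (F.antichain n i (F.closed n i) (sym (F.idempotent n i)) x≤v))
        where i = R⊆segment n Rx c<n
      ... | inj₂ (inj₂ v∥x) = inj₂ (segment⊆R n (F.closed n (R⊆segment n Rx c<n)) , v∥x)

    eventually-avoids : ∀ {N : Subset ℕ} {x} (vs : List A) → (∀ v → ¬ Unbounded (λ n → N n × F n x ≡ v)) →
      Σ[ k ∈ ℕ ] ∀ n → k ≤ₙ n → N n → F n x ∉ vs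
    eventually-avoids [] _ = 0 , λ n _ _ ()
    eventually-avoids {N} {x} (v ∷ vs) bounded with eventually-avoids vs bounded
      | byContradiction (λ none → bounded v λ k → byContradiction λ no → none (k , λ n k≤n Nn e → no (n , k≤n , Nn , e)))
    ... | k , out | k′ , out′ = k ⊔ k′ , λ where
      n le Nn (here e)  → out′ n (ℕ.m⊔n≤o⇒n≤o k k′ le) Nn e
      n le Nn (there i) → out n (ℕ.m⊔n≤o⇒m≤o k k′ le) Nn i

    refine : ∀ {N : Subset ℕ} {x} → Unbounded N → R x → Σ[ v ∈ A ] Unbounded (λ n → N n × F n x ≡ v)
    refine {N} {x} unbounded Rx = byContradiction λ none →
      let (vs , cover) = values-finite Rx
          (k , out) = eventually-avoids {N} {x} vs (λ v u → none (v , u))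
          (n , k≤n , Nn) = unbounded (k ⊔ suc (code x))
      in out n (ℕ.m⊔n≤o⇒m≤o k _ k≤n) Nn (cover _ (n , ℕ.m⊔n≤o⇒n≤o k _ k≤n , refl))

    Stage : Set₁
    Stage = Σ (Subset ℕ) Unbounded

    fix : ∀ n → Stage → Dec (Coded n) → Stage × (A → A)
    fix n (N , unbounded) (yes (x , _ , Rx)) =
      ((λ k → N k × F k x ≡ proj₁ (refine unbounded Rx)) , proj₂ (refine unbounded Rx)) , λ _ → proj₁ (refine unbounded Rx)
    fix n stage (no _) = stage , id

    -- A decreasing sequence of unbounded index sets; on the `n`-th one the values at all elements
    -- of `R` with code below `n` are constant.
    stage : ℕ → Stage
    stage zero    = (λ _ → ⊤) , λ k → k , ℕ.≤-refl , tt
    stage (suc n) = proj₁ (fix n (stage n) (em (Coded n)))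

    limit : A → A
    limit x = proj₂ (fix (code x) (stage (code x)) (em (Coded (code x)))) x

    stage-antitone : ∀ {m n} → m ≤ₙ n → ∀ {k} → proj₁ (stage n) k → proj₁ (stage m) k
    stage-antitone {zero} {zero} z≤n s = s
    stage-antitone {m} {suc n} m≤1+n s with ℕ.m≤n⇒m<n∨m≡n m≤1+n
    ... | inj₂ refl  = s
    ... | inj₁ m<1+n = stage-antitone (ℕ.m<1+n⇒m≤n m<1+n) (shrink (em (Coded n)) s)
      where
      shrink : ∀ d {k} → proj₁ (proj₁ (fix n (stage n) d)) k → proj₁ (stage n) k
      shrink (yes _) (s′ , _) = s′
      shrink (no _)  s′       = s′

    limit-agrees : ∀ {x n k} → R x → code x <ₙ n → proj₁ (stage n) k → F k x ≡ limit x
    limit-agrees {x} {n} {k} Rx c<n s = agree (em (Coded (code x))) (stage-antitone c<n s)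
      where
      agree : ∀ d → proj₁ (proj₁ (fix (code x) (stage (code x)) d)) k →
        F k x ≡ proj₂ (fix (code x) (stage (code x)) d) x
      agree (yes (y , cy , _)) (_ , e) with code-injective cy
      ... | refl = e
      agree (no none) _ = ⊥-elim (none (x , refl , Rx))

    agreeing : ∀ x y z → Σ[ n ∈ ℕ ] (∀ {w} → w ∈ (x ∷ y ∷ z ∷ []) → R w → w ∈ initial-segment n × F n w ≡ limit w)
    agreeing x y z = case proj₂ (stage m) m of λ (n , m≤n , s) → n , λ {w} i Rw →
      R⊆segment n Rw (ℕ.≤-trans (small i) m≤n) , limit-agrees Rw (small i) s
      where
      m = suc (code x ⊔ (code y ⊔ code z))
      small : ∀ {w} → w ∈ (x ∷ y ∷ z ∷ []) → code w <ₙ m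
      small (here refl)                 = s≤s (ℕ.m≤m⊔n (code x) _)
      small (there (here refl))         = s≤s (ℕ.≤-trans (ℕ.m≤m⊔n (code y) _) (ℕ.m≤n⊔m (code x) _))
      small (there (there (here refl))) = s≤s (ℕ.≤-trans (ℕ.m≤n⊔m (code y) _) (ℕ.m≤n⊔m (code x) _))

    -- Each condition involves at most two points at which `limit` is evaluated, so it is inherited
    -- from a single `F n` agreeing with `limit` there.
    limit-spine : SpineOn R limit
    limit-spine = record { closed = closed ; idempotent = idempotent ; comparable = comparable ; antichain = antichain }
      where
      first : ∀ {x y z : A} → x ∈ (x ∷ y ∷ z ∷ [])
      first = here refl
      second : ∀ {x y z : A} → y ∈ (x ∷ y ∷ z ∷ [])
      second = there (here refl)
      closed : ∀ {x} → R x → R (limit x)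
      closed {x} Rx with agreeing x x x
      ... | n , agree = subst R (proj₂ (agree first Rx)) (segment⊆R n (F.closed n (proj₁ (agree first Rx))))
      idempotent : ∀ {x} → R x → limit (limit x) ≡ limit x
      idempotent {x} Rx with agreeing x (limit x) x
      ... | n , agree = trans (sym (proj₂ (agree second (closed Rx))))
        (trans (cong (F n) (sym (proj₂ (agree first Rx)))) (trans (F.idempotent n (proj₁ (agree first Rx))) (proj₂ (agree first Rx))))
      comparable : ∀ {x y} → R x → R y → limit x ≤ limit y ⊎ limit y ≤ limit x
      comparable {x} {y} Rx Ry with agreeing x y x
      ... | n , agree with agree first Rx | agree second Ry
      ...   | i , ex | j , ey = subst₂ (λ u v → u ≤ v ⊎ v ≤ u) ex ey (F.comparable n i j)
      antichain : ∀ {x y} → R x → R y → limit x ≡ limit y → x ≤ y → x ≡ y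
      antichain {x} {y} Rx Ry e x≤y with agreeing x y x
      ... | n , agree with agree first Rx | agree second Ry
      ...   | i , ex | j , ey = F.antichain n i j (trans ex (trans e (sym ey))) x≤y

  -- Every element outside R has infinitely many fibres to join, so distinct ones can be chosen.
  thin⇒spine : ∀ {R f} → Thin R → SpineOn R f → (∀ {x} → ¬ R x → Infinite (λ c → R c × c ∥ x)) → PosetNotions.HasSpine _≤_
  thin⇒spine {R} {f} thin spine inf =
    -- The index type uses Boolean membership, whose proofs are unique, so that an index is
    -- determined by its representative.
    Γ , Γ-chain , (Σ[ c ∈ A ] ⟦ Γ ⟧ ∋ c) , (λ x → g x , ∋⁺ {Γ} (g-Γ x)) , (λ x y e → fibre x y (cong proj₁ e)) , met
    where
    open SpineOn spine
    Γ : Subset A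
    Γ c = R c × f c ≡ c
    Γ-chain : Chain Γ
    Γ-chain c d (Rc , fc) (Rd , fd) = subst₂ (λ u v → u ≤ v ⊎ v ≤ u) fc fd (comparable Rc Rd)

    free-fibres : ∀ {x} → ¬ R x → Infinite (FreeFibre R f x)
    free-fibres {x} ¬Rx with infinite⇒monotone (inf ¬Rx)
    ... | inj₁ asc  = asc⇒infinitely-many-freeFibres thin closed idempotent antichain asc
    ... | inj₂ desc = Op.asc⇒infinitely-many-freeFibres thin closed idempotent
      (λ Ry Rz e z≤y → sym (antichain Rz Ry (sym e) z≤y)) desc

    Outside : ℕ → Set
    Outside n = Σ[ x ∈ A ] code x ≡ n × ¬ R x
    fresh : ∀ {x} → ¬ R x → (used : List A) → Σ[ γ ∈ A ] FreeFibre R f x γ × γ ∉ used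
    fresh ¬Rx used = infinite-∖ (free-fibres ¬Rx) (used , λ _ i → i)
    assign : ∀ n → List A → Dec (Outside n) → List A × (A → A)
    assign n used (yes (x , _ , ¬Rx)) = proj₁ (fresh ¬Rx used) ∷ used , λ _ → proj₁ (fresh ¬Rx used)
    assign n used (no _)              = used , id
    history : ℕ → List A
    history zero    = []
    history (suc n) = proj₁ (assign n (history n) (em (Outside n)))
    join : A → A
    join x = proj₂ (assign (code x) (history (code x)) (em (Outside (code x)))) x
    history-mono : ∀ {m n} → m ≤ₙ n → ∀ {γ} → γ ∈ history m → γ ∈ history n
    history-mono {zero} {zero} z≤n i = i
    history-mono {m} {suc n} m≤1+n i with ℕ.m≤n⇒m<n∨m≡n m≤1+n
    ... | inj₂ refl  = i
    ... | inj₁ m<1+n = grow (em (Outside n)) (history-mono (ℕ.m<1+n⇒m≤n m<1+n) i)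
      where
      grow : ∀ d {γ} → γ ∈ history n → γ ∈ proj₁ (assign n (history n) d)
      grow (yes _) i′ = there i′
      grow (no _)  i′ = i′
    join-spec : ∀ {x} → ¬ R x → FreeFibre R f x (join x) × join x ∉ history (code x) × join x ∈ history (suc (code x))
    join-spec {x} ¬Rx = spec (em (Outside (code x)))
      where
      spec : ∀ d → let (used , j) = assign (code x) (history (code x)) d in
        FreeFibre R f x (j x) × j x ∉ history (code x) × j x ∈ used
      spec (no none) = ⊥-elim (none (x , refl , ¬Rx))
      spec (yes (y , cy , ¬Ry)) with code-injective cy
      ... | refl with fresh ¬Ry (history (code x))
      ...   | γ , free , γ∉ = free , γ∉ , here refl
    join-fresh : ∀ {x y} → ¬ R x → ¬ R y → code x <ₙ code y → join x ≢ join y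
    join-fresh {x} {y} ¬Rx ¬Ry cx<cy e = proj₁ (proj₂ (join-spec ¬Ry))
      (subst (_∈ history (code y)) e (history-mono cx<cy (proj₂ (proj₂ (join-spec ¬Rx)))))

    g : A → A
    g x = choose (em (R x)) (f x) (join x)
    g-in : ∀ {x} → R x → g x ≡ f x
    g-in {x} = choose-yes (em (R x))
    g-out : ∀ {x} → ¬ R x → g x ≡ join x
    g-out {x} = choose-no (em (R x))
    g-Γ : ∀ x → Γ (g x)
    g-Γ x with em (R x)
    ... | yes Rx = closed Rx , idempotent Rx
    ... | no ¬Rx with proj₁ (join-spec ¬Rx)
    ...   | Rγ , fγ , _ = Rγ , fγ
    free : ∀ {x y} → R x → ¬ R y → g x ≡ g y → x ∥ y
    free Rx ¬Ry e = proj₂ (proj₂ (proj₁ (join-spec ¬Ry))) Rx (trans (sym (g-in Rx)) (trans e (g-out ¬Ry)))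
    fibre : ∀ x y → g x ≡ g y → x ≤ y → x ≡ y
    fibre x y e x≤y with em (R x) | em (R y)
    ... | yes Rx | yes Ry = antichain Rx Ry e x≤y
    ... | yes Rx | no ¬Ry = ⊥-elim (∥⇒≰ (free Rx ¬Ry (trans (g-in Rx) (trans e (sym (g-out ¬Ry))))) x≤y)
    ... | no ¬Rx | yes Ry = ⊥-elim (∥⇒≱ (free Ry ¬Rx (trans (g-in Ry) (trans (sym e) (sym (g-out ¬Rx))))) x≤y)
    ... | no ¬Rx | no ¬Ry with ℕ.<-cmp (code x) (code y)
    ...   | tri< lt _ _ = ⊥-elim (join-fresh ¬Rx ¬Ry lt e)
    ...   | tri≈ _ eq _ = code-injective eq
    ...   | tri> _ _ gt = ⊥-elim (join-fresh ¬Ry ¬Rx gt (sym e))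
    met : ∀ (i : Σ[ c ∈ A ] ⟦ Γ ⟧ ∋ c) → Σ[ c ∈ A ] Γ c × (g c , ∋⁺ {Γ} (g-Γ c)) ≡ i
    met (c , p) = c , Γc , same (trans (g-in (proj₁ Γc)) (proj₂ Γc))
      where
      Γc : Γ c
      Γc = ∋⁻ {Γ} {c} p
      same : ∀ {d} {q : ⟦ Γ ⟧ ∋ d} → d ≡ c → (d , q) ≡ (c , p)
      same {q = q} refl = cong (c ,_) (≡-irrelevant q p)

  -- The thin set of a maximal safe chain and its spine

  Unavoidable : Sub → Subset A
  Unavoidable D x = Finite (λ d → D ∋ d × d ∥ x)

  -- Let `x` and `y` lie outside `D`. Then `y` is incomparable to some `d` in `D`. If `d ∥ x`, then
  -- `d` is one of finitely many and `y` is beside it; otherwise `y` is outside the gap of `x` and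
  -- `neighbours-finite` applies.
  unavoidable-thin : ∀ {D} → Safe D → Maximal Safe D → Thin (Unavoidable D)
  unavoidable-thin {D} safe maximal {x} Rx with em (D ∋ x)
  ... | yes Dx = finite-⊆ (λ y (Ry , y∥x) → y∥x , Ry) (proj₂ safe Dx)
  ... | no x∉D = finite-⊆ classify (finite-∪ (finite-∪ Rx (finite-⋃ BesideD (proj₁ Rx) besideD-finite))
      (neighbours-finite {D} safe x x (λ Dd d≤x → d≤x , λ { refl → x∉D Dd }) (λ Dd x≤d → x≤d , λ { refl → x∉D Dd })))
    where
    BesideD : A → Subset A
    BesideD d y = D ∋ d × Beside (D ∋_) d y
    besideD-finite : ∀ d → Finite (BesideD d)
    besideD-finite d with em (D ∋ d)
    ... | yes Dd = finite-⊆ (λ _ → proj₂) (proj₂ safe Dd)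
    ... | no d∉D = [] , λ y (Dd , _) → ⊥-elim (d∉D Dd)
    classify : ∀ y → Unavoidable D y × y ∥ x →
      ((D ∋ y × y ∥ x) ⊎ (Σ[ d ∈ A ] d ∈ proj₁ Rx × BesideD d y)) ⊎
      (Beside (D ∋_) x y × ((Σ[ d ∈ A ] D ∋ d × d ≤ x × ¬ d < y) ⊎ (Σ[ d ∈ A ] D ∋ d × x ≤ d × ¬ y < d)))
    classify y (Ry , y∥x) with em (D ∋ y)
    ... | yes Dy = inj₁ (inj₁ (Dy , y∥x))
    ... | no y∉D with maximal-safe-decides safe maximal y∉D
    ...   | d , Dd , d∥y with compare d x
    ...     | inj₁ d≤x        = inj₂ ((y∥x , Ry) , inj₁ (d , Dd , d≤x , λ d<y → ∥⇒≰ d∥y (proj₁ d<y)))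
    ...     | inj₂ (inj₁ x≤d) = inj₂ ((y∥x , Ry) , inj₂ (d , Dd , x≤d , λ y<d → ∥⇒≱ d∥y (proj₁ y<d)))
    ...     | inj₂ (inj₂ d∥x) = inj₁ (inj₂ (d , proj₂ Rx d (Dd , d∥x) , Dd , ∥-sym d∥y , Ry))

  spine : PosetNotions.HasSpine _≤_
  spine = case zorn Safe safe-closed empty-safe of λ (D , safe , _ , maximal) → build D safe maximal
    where
    empty-safe : Safe (λ _ → false)
    empty-safe = (λ x y ()) , λ ()
    build : ∀ D → Safe D → Maximal Safe D → PosetNotions.HasSpine _≤_
    -- An `x` outside the thin set is incomparable to infinitely many members of `D`, all of which
    -- belong to the thin set since `D` is a chain.
    build D safe maximal = thin⇒spine thin (Compactness.limit-spine (Unavoidable D) thin) λ ¬Rx fin →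
      ¬Rx (finite-⊆ (λ d (Dd , d∥x) → chain⊆R Dd , d∥x) fin)
      where
      thin : Thin (Unavoidable D)
      thin = unavoidable-thin {D} safe maximal
      chain⊆R : ∀ {d} → D ∋ d → Unavoidable D d
      chain⊆R {d} Dd = [] , λ e (De , e∥d) → case proj₁ safe e d De Dd of λ where
        (inj₁ e≤d) → ⊥-elim (∥⇒≰ e∥d e≤d)
        (inj₂ d≤e) → ⊥-elim (∥⇒≱ e∥d d≤e)

mainTheorem2 : ExcludedMiddle →
    (A : Set) (_≤_ : A → A → Set) → IsPartialOrder _≡_ _≤_ →
    Countable A →
    PosetNotions.NoInfiniteAntichain _≤_ →
    PosetNotions.Vacillating _≤_ →
    PosetNotions.HasSpine _≤_
mainTheorem2 em A _≤_ po (code , code-injective) noInfiniteAntichain vacillating =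
  Vacillating.spine em _≤_ po code code-injective noInfiniteAntichain vacillating
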